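{- Let $1\le r\le s\le t$ and $n=r+s+t+1$. Then the $(2r+2)$-wide diameter of $E3C(r,s,t)$ satisfies $D_{2r+2}(E3C(r,s,t))\le r+s+t+6=n+5$.
   Context: The exchanged 3-ary $n$-cube $E3C(r,s,t)$ ($r,s,t\ge1$, $n=r+s+t+1$): vertices are strings written $x=ABCd$ with $A\in\{0,1,2\}^r$, $B\in\{0,1,2\}^s$, $C\in\{0,1,2\}^t$, $d\in\{0,1,2\}$. Two distinct vertices $x=ABCd$, $y=A'B'C'd'$ are adjacent iff one of: (E0) $A=A',B=B',C=C'$ and $d\ne d'$; (E1) $d=d'=0$, $A=A'$, $B=B'$ and $C,C'$ differ in exactly one position; (E2) $d=d'=1$, $A=A'$, $C=C'$ and $B,B'$ differ in exactly one position; (E3) $d=d'=2$, $B=B'$, $C=C'$ and $A,A'$ differ in exactly one position. For a graph $G$ and positive integer $\beta\le\kappa(G)$ (vertex connectivity), the $\beta$-wide diameter $D_\beta(G)$ is the maximum over distinct $u,v\in V(G)$ of the minimum, over all families of $\beta$ pairwise internally disjoint $u$–$v$ paths, of the maximum length of a path in the family. (It is known that $\kappa(E3C(r,s,t))=2r+2$ when $r\le s\le t$.) -}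

module Defs where

open import Data.Fin using (Fin; zero; suc)
open import Data.List using (List; _∷_; _∷ʳ_; length)
open import Data.List.Relation.Binary.Disjoint.Propositional using (Disjoint)
open import Data.List.Relation.Unary.Linked using (Linked)
open import Data.List.Relation.Unary.Unique.Propositional using (Unique)
open import Data.Nat using (ℕ; suc; _≤_)
open import Data.Product using (Σ; ∃; ∃!; _×_; _,_)
open import Data.Vec using (Vec; lookup)
open import Relation.Binary.PropositionalEquality using (_≡_; _≢_; refl; ≢-sym)
open import Relation.Nullary using (¬_)

record Graph : Set₁ where
  infix 4 _~_
  field
    V        : Set
    _~_      : V → V → Set
    ~-sym    : ∀ {x y} → x ~ y → y ~ x
    ~-irrefl : ∀ {x} → ¬ (x ~ x)

module _ (G : Graph) where
  open Graph G

  -- A path between distinct u and v is stored as the list of its internal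
  -- vertices, in order from u to v.
  record Path (u v : V) : Set where
    field
      interior : List V
    vertices : List V
    vertices = u ∷ (interior ∷ʳ v)
    field
      linked   : Linked _~_ vertices
      distinct : Unique vertices

  open Path

  -- The number of edges.
  pathLength : ∀ {u v} → Path u v → ℕ
  pathLength p = suc (length (interior p))

  -- Disjointness of interiors alone would allow the one-edge path, whose
  -- interior is empty, to be repeated; hence the members are also required
  -- to be different paths.
  record DisjointPaths (β : ℕ) (u v : V) : Set where
    field
      path      : Fin β → Path u v
      different : ∀ i j → i ≢ j → vertices (path i) ≢ vertices (path j)
      disjoint  : ∀ i j → i ≢ j → Disjoint (interior (path i)) (interior (path j))

  IsMaxLength : ∀ {β u v} → DisjointPaths β u v → ℕ → Set
  IsMaxLength F m = (∃ λ i → pathLength (path i) ≡ m) × (∀ i → pathLength (path i) ≤ m)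
    where open DisjointPaths F

  -- The minimum, over all families, of the maximum length in the family.
  IsWideDistance : ℕ → V → V → ℕ → Set
  IsWideDistance β u v m =
      (Σ (DisjointPaths β u v) λ F → IsMaxLength F m)
    × (∀ (F : DisjointPaths β u v) k → IsMaxLength F k → m ≤ k)

  -- The wide distance is undefined for a pair without β internally disjoint
  -- paths (excluded when β ≤ κ(G)).  `bound` requires it to be defined for every
  -- pair of distinct vertices, so that no pair is dropped from the maximum.
  record IsWideDiameter (β D : ℕ) : Set where
    field
      attained : ∃ λ u → ∃ λ v → u ≢ v × IsWideDistance β u v D
      bound    : ∀ u v → u ≢ v → ∃ λ m → IsWideDistance β u v m × m ≤ D

DifferInOne : ∀ {k} → Vec (Fin 3) k → Vec (Fin 3) k → Set
DifferInOne X Y = ∃! _≡_ λ i → lookup X i ≢ lookup Y i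

module _ (r s t : ℕ) where

  E3CVertex : Set
  E3CVertex = Vec (Fin 3) r × Vec (Fin 3) s × Vec (Fin 3) t × Fin 3

  data E3CAdj : E3CVertex → E3CVertex → Set where
    E0 : ∀ {A B C d d′} → d ≢ d′ →
         E3CAdj (A , B , C , d) (A , B , C , d′)
    E1 : ∀ {A B C C′} → DifferInOne C C′ →
         E3CAdj (A , B , C , zero) (A , B , C′ , zero)
    E2 : ∀ {A B B′ C} → DifferInOne B B′ →
         E3CAdj (A , B , C , suc zero) (A , B′ , C , suc zero)
    E3 : ∀ {A A′ B C} → DifferInOne A A′ →
         E3CAdj (A , B , C , suc (suc zero)) (A′ , B , C , suc (suc zero))

DifferInOne-sym : ∀ {k} (X Y : Vec (Fin 3) k) → DifferInOne X Y → DifferInOne Y X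
DifferInOne-sym _ _ (i , ne , uniq) = i , ≢-sym ne , λ ne′ → uniq (≢-sym ne′)

DifferInOne-irrefl : ∀ {k} (X : Vec (Fin 3) k) → ¬ DifferInOne X X
DifferInOne-irrefl _ (_ , ne , _) = ne refl

E3CAdj-sym : ∀ {r s t x y} → E3CAdj r s t x y → E3CAdj r s t y x
E3CAdj-sym (E0 d≢d′) = E0 (≢-sym d≢d′)
E3CAdj-sym (E1 {C = X} {C′ = Y} δ) = E1 (DifferInOne-sym X Y δ)
E3CAdj-sym (E2 {B = X} {B′ = Y} δ) = E2 (DifferInOne-sym X Y δ)
E3CAdj-sym (E3 {A = X} {A′ = Y} δ) = E3 (DifferInOne-sym X Y δ)

E3CAdj-irrefl : ∀ {r s t x} → ¬ E3CAdj r s t x x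
E3CAdj-irrefl (E0 d≢d) = d≢d refl
E3CAdj-irrefl (E1 {C = X} δ) = DifferInOne-irrefl X δ
E3CAdj-irrefl (E2 {B = X} δ) = DifferInOne-irrefl X δ
E3CAdj-irrefl (E3 {A = X} δ) = DifferInOne-irrefl X δ

E3C : ℕ → ℕ → ℕ → Graph
E3C r s t = record
  { V        = E3CVertex r s t
  ; _~_      = E3CAdj r s t
  ; ~-sym    = E3CAdj-sym
  ; ~-irrefl = E3CAdj-irrefl
  }

{-# OPTIONS --safe #-}
module Submission where

-- Call C, B, A the axes 0, 1, 2: in layer d only axis d can be moved along, and
-- permuting the axes together with the layers is an isomorphism.  So u may be
-- taken in layer 0 and v in layer 0 or 1.  Write u = (x₀, x₁, x₂) and
-- v = (y₀, y₁, y₂), coordinates being listed by axis.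
--
-- Same layer: a Hamming graph of dimension k has 2k internally disjoint
-- x₀–y₀ paths of length at most k + 1.  Each of them is cut after its first
-- vertex e, and the missing changes x₁ → y₁ and x₂ → y₂ are made at e, in
-- layers 1 and 2.  Two more paths leave u through its neighbours in layers 1 and 2.
--
-- Layers 0 and 1: pair neighbours p of x₀ with neighbours q of y₁.  A generic
-- path goes (p,x₁,x₂), (p,q,x₂), (p,q,y₂), (y₀,q,y₂) between u and v; three
-- special paths use up the remaining neighbours of u and v.
--
-- Disjointness is witnessed by a colouring of the vertices in which every
-- internal vertex of the i-th path has colour i; walks need not be simple,
-- since loops can be erased.

open import Data.Bool using (true; false; if_then_else_)
open import Data.Fin using (Fin; zero; suc; inject≤)
open import Data.Fin.Patterns using (0F; 1F; 2F)
import Data.Fin.Properties as Fin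
open import Data.List using (List; []; _∷_; _∷ʳ_; length)
import Data.List.Base as L
import Data.List.Membership.DecPropositional as DecMembership
open import Data.List.Membership.Propositional using (_∈_; _∉_)
import Data.List.Properties as List
open import Data.List.Relation.Binary.Disjoint.Propositional using (Disjoint)
open import Data.List.Relation.Unary.All as All using (All; []; _∷_)
open import Data.List.Relation.Unary.All.Properties using (¬Any⇒All¬; ∷ʳ⁺)
open import Data.List.Relation.Unary.AllPairs using ([]; _∷_)
open import Data.List.Relation.Unary.Any using (here; there)
open import Data.List.Relation.Unary.Linked using (Linked; [-]; _∷_; linked?)
import Data.List.Relation.Unary.Unique.DecPropositional as DecUnique
open import Data.List.Relation.Unary.Unique.Propositional using (Unique)
open import Data.Maybe as Maybe using (Maybe; just; nothing; maybe′)
open import Data.Maybe.Properties using (just-injective)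
open import Data.Nat using (ℕ; zero; suc; _+_; _*_; _≤_; z≤n; s≤s)
import Data.Nat.Properties as ℕ
open import Data.Nat.Tactic.RingSolver using (solve; solve-∀)
open import Data.Product using (Σ; ∃; ∃₂; _×_; _,_; proj₁; proj₂)
open import Data.Product.Properties using (≡-dec)
open import Data.Sum as Sum using (_⊎_; inj₁; inj₂)
open import Data.Unit using (⊤; tt)
open import Data.Vec using (Vec; []; _∷_; lookup; tabulate; replicate)
import Data.Vec.Properties as Vec
open import Data.Vec.Relation.Unary.All as VecAll using ([]; _∷_)
import Data.Vec.Relation.Unary.All.Properties as VecAllP
open import Function using (_∘_; id)
open import Relation.Binary.Definitions using (DecidableEquality)
open import Relation.Binary.PropositionalEquality using (_≡_; _≢_; refl; sym; trans; cong; cong₂; subst; ≢-sym)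
open import Relation.Nullary using (¬_; Dec; yes; no; does; contradiction)
open import Relation.Nullary.Decidable using (True; toWitness; map′; ¬?; _×-dec_; _→-dec_; dec-true; dec-false)
open import Defs


-- Existence of the wide diameter of a finite graph

SearchIn : ∀ {A : Set} → (A → Set) → Set₁
SearchIn {A} Q = {P : A → Set} → (∀ x → Dec (P x)) → Dec (∃ λ x → Q x × P x)

Searchable : Set → Set₁
Searchable A = {P : A → Set} → (∀ x → Dec (P x)) → Dec (∃ P)

search-× : ∀ {A B} → Searchable A → Searchable B → Searchable (A × B)
search-× searchA searchB P? =
  map′ (λ { (a , b , p) → (a , b) , p }) (λ { ((a , b) , p) → a , b , p })
       (searchA (λ a → searchB (λ b → P? (a , b))))

search-Vec : ∀ {A} → Searchable A → ∀ n → Searchable (Vec A n)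
search-Vec search zero P? = map′ ([] ,_) (λ { ([] , p) → p }) (P? [])
search-Vec search (suc n) P? =
  map′ (λ { (x , xs , p) → x ∷ xs , p }) (λ { (x ∷ xs , p) → x , xs , p })
       (search (λ x → search-Vec search n (λ xs → P? (x ∷ xs))))

search-List : ∀ {A} → Searchable A → ∀ n → SearchIn {List A} (λ xs → length xs ≤ n)
search-List search zero P? =
  map′ (λ p → [] , z≤n , p) (λ { ([] , _ , p) → p }) (P? [])
search-List search (suc n) P? with P? []
... | yes p = yes ([] , z≤n , p)
... | no ¬p =
  map′ (λ { (x , xs , xs≤n , p) → x ∷ xs , s≤s xs≤n , p })
       (λ { ([] , _ , p) → contradiction p ¬p ; (x ∷ xs , s≤s xs≤n , p) → x , xs , xs≤n , p })
       (search (λ x → search-List search n (λ xs → P? (x ∷ xs))))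

search-VecIn : ∀ {A} {Q : A → Set} → SearchIn Q → ∀ n → SearchIn (VecAll.All Q {n})
search-VecIn search zero P? =
  map′ (λ p → [] , [] , p) (λ { ([] , [] , p) → p }) (P? [])
search-VecIn search (suc n) P? =
  map′ (λ { (x , q , xs , qs , p) → x ∷ xs , q ∷ qs , p })
       (λ { (x ∷ xs , q ∷ qs , p) → x , q , xs , qs , p })
       (search (λ x → search-VecIn search n (λ xs → P? (x ∷ xs))))

least : {P : ℕ → Set} → (∀ n → Dec (P n)) → ∀ {n} → P n →
        ∃ λ m → m ≤ n × P m × (∀ k → P k → m ≤ k)
least P? {zero} p = zero , z≤n , p , λ _ _ → z≤n
least {P} P? {suc n} p with P? zero
... | yes p₀ = zero , z≤n , p₀ , λ _ _ → z≤n
... | no ¬p₀ with least {P ∘ suc} (P? ∘ suc) p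
...   | m , m≤n , pm , low = suc m , s≤s m≤n , pm ,
        λ { zero p₀ → contradiction p₀ ¬p₀ ; (suc k) pk → s≤s (low k pk) }

greatest : {P : ℕ → Set} → (∀ n → Dec (P n)) → ∃ P → ∀ L → (∀ n → P n → n ≤ L) →
           ∃ λ m → m ≤ L × P m × (∀ k → P k → k ≤ m)
greatest P? (n , p) zero high with high n p
... | z≤n = zero , z≤n , p , high
greatest P? ex (suc L) high with P? (suc L)
... | yes p = suc L , ℕ.≤-refl , p , high
... | no ¬p with greatest P? ex L (λ n p → ℕ.≤-pred (ℕ.≤∧≢⇒< (high n p) λ { refl → ¬p p }))
...   | m , m≤L , pm , top = m , ℕ.m≤n⇒m≤1+n m≤L , pm , top

argmax : ∀ {k} (f : Fin (suc k) → ℕ) → ∃ λ i → ∀ j → f j ≤ f i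
argmax {zero} f = zero , λ { zero → ℕ.≤-refl }
argmax {suc k} f with argmax (f ∘ suc)
... | i , top with ℕ.≤-total (f zero) (f (suc i))
...   | inj₁ le = suc i , λ { zero → le ; (suc j) → top j }
...   | inj₂ ge = zero , λ { zero → ℕ.≤-refl ; (suc j) → ℕ.≤-trans (top j) ge }

module WideDistance (G : Graph) (_≟_ : DecidableEquality (Graph.V G))
                    (_~?_ : ∀ x y → Dec (Graph._~_ G x y)) (search : Searchable (Graph.V G)) where

  open Graph G
  open DisjointPaths

  BoundedFamily : ℕ → V → V → ℕ → Set
  BoundedFamily β u v n = Σ (DisjointPaths G β u v) λ F → ∀ i → length (Path.interior (path F i)) ≤ n

  module _ (u v : V) where

    extend : List V → List V
    extend xs = u ∷ (xs ∷ʳ v)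

    Valid : List V → Set
    Valid xs = Linked _~_ (extend xs) × Unique (extend xs)

    Compatible : List V → List V → Set
    Compatible xs ys = (extend xs ≢ extend ys) × Disjoint xs ys

    Good : ∀ {β} → Vec (List V) β → Set
    Good xss = (∀ i → Valid (lookup xss i)) ×
               (∀ i j → i ≢ j → Compatible (lookup xss i) (lookup xss j))

    valid? : ∀ xs → Dec (Valid xs)
    valid? xs = linked? _~?_ (extend xs) ×-dec DecUnique.unique? _≟_ (extend xs)

    disjoint? : (xs ys : List V) → Dec (Disjoint xs ys)
    disjoint? xs ys =
      map′ (λ a {z} (z∈xs , z∈ys) → All.lookup a z∈xs z∈ys) (λ d → All.tabulate (λ z∈xs z∈ys → d (z∈xs , z∈ys)))
           (All.all? (λ z → ¬? (z ∈? ys)) xs)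
      where open import Data.List.Membership.DecPropositional _≟_ using (_∈?_)

    compatible? : ∀ xs ys → Dec (Compatible xs ys)
    compatible? xs ys = ¬? (List.≡-dec _≟_ (extend xs) (extend ys)) ×-dec disjoint? xs ys

    good? : ∀ {β} (xss : Vec (List V) β) → Dec (Good xss)
    good? xss = Fin.all? (λ i → valid? (lookup xss i)) ×-dec
                Fin.all? (λ i → Fin.all? (λ j →
                  ¬? (i Fin.≟ j) →-dec compatible? (lookup xss i) (lookup xss j)))

    toFamily : ∀ {β n} → (∃ λ xss → VecAll.All (λ xs → length xs ≤ n) xss × Good {β} xss) →
               BoundedFamily β u v n
    toFamily (xss , short , valid , compatible) =
      record
        { path = λ i → record { interior = lookup xss i ; linked = proj₁ (valid i) ; distinct = proj₂ (valid i) }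
        ; different = λ i j i≢j → proj₁ (compatible i j i≢j)
        ; disjoint = λ i j i≢j → proj₂ (compatible i j i≢j)
        } , λ i → VecAllP.lookup⁺ short i

    fromFamily : ∀ {β n} → BoundedFamily β u v n →
                 ∃ λ xss → VecAll.All (λ xs → length xs ≤ n) xss × Good {β} xss
    fromFamily (F , short) = tabulate xs , VecAllP.tabulate⁺ short , valid , compatible
      where
      xs : _ → List V
      xs i = Path.interior (path F i)
      valid : ∀ i → Valid (lookup (tabulate xs) i)
      valid i rewrite Vec.lookup∘tabulate xs i = Path.linked (path F i) , Path.distinct (path F i)
      compatible : ∀ i j → i ≢ j → Compatible (lookup (tabulate xs) i) (lookup (tabulate xs) j)
      compatible i j i≢j rewrite Vec.lookup∘tabulate xs i | Vec.lookup∘tabulate xs j =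
        different F i j i≢j , disjoint F i j i≢j

    boundedFamily? : ∀ β n → Dec (BoundedFamily β u v n)
    boundedFamily? β n = map′ toFamily fromFamily (search-VecIn (search-List search n) β good?)

    wideDistance : ∀ {β n} → BoundedFamily (suc β) u v n →
                   ∃ λ m → IsWideDistance G (suc β) u v m × m ≤ suc n
    wideDistance {β} F₀ with least (boundedFamily? (suc β)) F₀
    ... | m , m≤n , (F , short) , low with argmax (λ i → length (Path.interior (path F i)))
    ...   | i , top = suc m ,
            ((F , (i , cong suc (ℕ.≤-antisym (short i) (low _ (F , top)))) , s≤s ∘ short) , minimal) , s≤s m≤n
      where
      minimal : ∀ (F′ : DisjointPaths G (suc β) u v) k → IsMaxLength G F′ k → suc m ≤ k
      minimal F′ (suc k) (_ , bound) = s≤s (low k (F′ , λ j → ℕ.≤-pred (bound j)))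
      minimal F′ zero (_ , bound) = contradiction (bound zero) λ ()

  wideDistance-unique : ∀ {β u v m n} → IsWideDistance G β u v m → IsWideDistance G β u v n → m ≡ n
  wideDistance-unique ((F , maxF) , lowF) ((F′ , maxF′) , lowF′) =
    ℕ.≤-antisym (lowF F′ _ maxF′) (lowF′ F _ maxF)

  wideDiameter : ∀ β n → (∃₂ λ (u v : V) → u ≢ v) → (∀ u v → u ≢ v → BoundedFamily (suc β) u v n) →
                 ∃ λ D → IsWideDiameter G (suc β) D × D ≤ suc n
  wideDiameter β n (u₀ , v₀ , u₀≢v₀) family
    with greatest attained? (_ , _ , _ , u₀≢v₀ , proj₁ (proj₂ (distance u₀ v₀ u₀≢v₀))) (suc n) bounded
    where
    distance : ∀ u v → u ≢ v → ∃ λ m → IsWideDistance G (suc β) u v m × m ≤ suc n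
    distance u v u≢v = wideDistance u v (family u v u≢v)

    Attained : ℕ → Set
    Attained D = ∃₂ λ u v → u ≢ v × IsWideDistance G (suc β) u v D

    attained? : ∀ D → Dec (Attained D)
    attained? D = search (λ u → search (λ v → check u v))
      where
      check : ∀ u v → Dec (u ≢ v × IsWideDistance G (suc β) u v D)
      check u v with u ≟ v
      ... | yes u≡v = no λ { (u≢v , _) → u≢v u≡v }
      ... | no u≢v with distance u v u≢v
      ...   | m , wd , _ with m ℕ.≟ D
      ...     | yes refl = yes (u≢v , wd)
      ...     | no m≢D = no λ { (_ , wd′) → m≢D (wideDistance-unique wd wd′) }

    bounded : ∀ D → Attained D → D ≤ suc n
    bounded D (u , v , u≢v , wd) with distance u v u≢v
    ... | m , wd′ , m≤ = subst (_≤ suc n) (wideDistance-unique wd′ wd) m≤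
  ... | D , D≤ , (u , v , u≢v , wd) , top = D , record
    { attained = u , v , u≢v , wd
    ; bound = λ u v u≢v → let m , wd , _ = wideDistance u v (family u v u≢v) in
                          m , wd , top m (u , v , u≢v , wd)
    } , D≤

-- Coloured families of walks

module Walks (G : Graph) where

  open Graph G

  -- The index n only bounds the number of edges; P holds at both ends too.
  data Walk (P : V → Set) : V → V → ℕ → Set where
    stop : ∀ {x n} → P x → Walk P x x n
    step : ∀ {x y z n} → P x → x ~ y → Walk P y z n → Walk P x z (suc n)

  record Route (P : V → Set) (u v : V) (n : ℕ) : Set where
    constructor route
    field
      {first last} : V
      enter : u ~ first
      walk  : Walk P first last n
      leave : last ~ v

  -- At most one member, the one with index zero, may be the edge u ~ v; the others
  -- are then different paths because their interiors are non-empty and disjoint.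
  record Family (u v : V) (K n : ℕ) : Set where
    field
      colour   : V → Maybe (Fin (suc K))
      colour-u : colour u ≡ nothing
      colour-v : colour v ≡ nothing
      member   : ∀ i → (i ≡ zero × u ~ v) ⊎ Route (λ w → colour w ≡ just i) u v n

  weaken : ∀ {P x y m n} → m ≤ n → Walk P x y m → Walk P x y n
  weaken _ (stop p) = stop p
  weaken (s≤s le) (step p e W) = step p e (weaken le W)

  join : ∀ {P x y z w m n} → Walk P x y m → y ~ z → Walk P z w n → Walk P x w (m + suc n)
  join {m = m} (stop p) e W = weaken (ℕ.m≤n+m _ m) (step p e W)
  join (step p e′ W′) e W = step p e′ (join W′ e W)

  starts : ∀ {P x y n} → Walk P x y n → P x
  starts (stop p) = p
  starts (step p _ _) = p

  ends : ∀ {P x y n} → Walk P x y n → P y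
  ends (stop p) = p
  ends (step _ _ W) = ends W

  reverse : ∀ {P x y n} → Walk P x y n → Walk P y x n
  reverse (stop p) = stop p
  reverse {n = suc n} (step p e W) =
    subst (Walk _ _ _) (ℕ.+-comm n 1) (join (reverse W) (~-sym e) (stop {n = zero} p))

  vertices : ∀ {P x y n} → Walk P x y n → List V
  vertices (stop {x} _) = x ∷ []
  vertices (step {x} _ _ W) = x ∷ vertices W

  vertices-all : ∀ {P x y n} (W : Walk P x y n) → All P (vertices W)
  vertices-all (stop p) = p ∷ []
  vertices-all (step p _ W) = p ∷ vertices-all W

  vertices-length : ∀ {P x y n} (W : Walk P x y n) → length (vertices W) ≤ suc n
  vertices-length (stop _) = s≤s z≤n
  vertices-length (step _ _ W) = s≤s (vertices-length W)

  vertices-linked : ∀ {P u x y v n} → u ~ x → (W : Walk P x y n) → y ~ v →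
                    Linked _~_ (u ∷ (vertices W ∷ʳ v))
  vertices-linked e (stop _) e′ = e ∷ e′ ∷ [-]
  vertices-linked e (step _ f W) e′ = e ∷ vertices-linked f W e′

  Simple : (P : V → Set) → V → V → ℕ → Set
  Simple P x y n = Σ (Walk P x y n) λ W → Unique (vertices W)

  suffix : ∀ {P x y z n} (W : Walk P x y n) → Unique (vertices W) → z ∈ vertices W →
           ∃ λ m → m ≤ n × Simple P z y m
  suffix W@(stop _) uW (here refl) = _ , ℕ.≤-refl , W , uW
  suffix W@(step _ _ _) uW (here refl) = _ , ℕ.≤-refl , W , uW
  suffix (step _ _ W) (_ ∷ uW) (there z∈) with suffix W uW z∈
  ... | m , m≤n , S = m , ℕ.m≤n⇒m≤1+n m≤n , S

  simplify : DecidableEquality V → ∀ {P x y n} → Walk P x y n → ∃ λ m → m ≤ n × Simple P x y m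
  simplify _≟_ (stop p) = _ , ℕ.≤-refl , stop p , [] ∷ []
  simplify _≟_ (step {x} p e W) with simplify _≟_ W
  ... | m , m≤n , W′ , uW′ with DecMembership._∈?_ _≟_ x (vertices W′)
  ...   | no x∉ = suc m , s≤s m≤n , step p e W′ , ¬Any⇒All¬ _ x∉ ∷ uW′
  ...   | yes x∈ with suffix W′ uW′ x∈
  ...     | l , l≤m , S = l , ℕ.m≤n⇒m≤1+n (ℕ.≤-trans l≤m m≤n) , S

  unique-∷ʳ : ∀ {xs : List V} {v} → Unique xs → v ∉ xs → Unique (xs ∷ʳ v)
  unique-∷ʳ [] _ = [] ∷ []
  unique-∷ʳ (x∉ ∷ uxs) v∉ = ∷ʳ⁺ x∉ (λ { refl → v∉ (here refl) }) ∷ unique-∷ʳ uxs (v∉ ∘ there)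

  simplePath : ∀ {P u v n} → u ≢ v → ¬ P u → ¬ P v → ∀ {x y} → u ~ x → Simple P x y n → y ~ v → Path G u v
  simplePath {P} {u} {v} u≢v ¬Pu ¬Pv e (W , uW) e′ = record
    { interior = vertices W
    ; linked   = vertices-linked e W e′
    ; distinct = ∷ʳ⁺ (All.map (λ { p refl → ¬Pu p }) (vertices-all W)) u≢v
                 ∷ unique-∷ʳ uW (λ v∈ → ¬Pv (All.lookup (vertices-all W) v∈))
    }

  module _ {u v : V} {K n : ℕ} (_≟_ : DecidableEquality V) (u≢v : u ≢ v) (F : Family u v K n) where
    open Family F

    Coloured : Fin (suc K) → V → Set
    Coloured i w = colour w ≡ just i

    record ColouredPath (i : Fin (suc K)) : Set where
      field
        path     : Path G u v
        coloured : All (Coloured i) (Path.interior path)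
        short    : length (Path.interior path) ≤ suc n
        direct   : Path.interior path ≡ [] → i ≡ zero

    colouredPath : ∀ i → ColouredPath i
    colouredPath i with member i
    ... | inj₁ (i≡0 , e) = record
      { path = record { interior = [] ; linked = e ∷ [-] ; distinct = (u≢v ∷ []) ∷ [] ∷ [] }
      ; coloured = [] ; short = z≤n ; direct = λ _ → i≡0 }
    ... | inj₂ (route e W e′) with simplify _≟_ W
    ...   | m , m≤n , S = record
      { path = simplePath u≢v (uncoloured colour-u) (uncoloured colour-v) e S e′
      ; coloured = vertices-all (proj₁ S)
      ; short = ℕ.≤-trans (vertices-length (proj₁ S)) (s≤s m≤n)
      ; direct = nonempty (proj₁ S) }
      where
      uncoloured : ∀ {w} → colour w ≡ nothing → ¬ Coloured i w
      uncoloured eq eq′ with trans (sym eq) eq′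
      ... | ()
      nonempty : ∀ {x y m} (W : Walk (Coloured i) x y m) → vertices W ≡ [] → i ≡ zero
      nonempty (stop _) ()
      nonempty (step _ _ _) ()

    open ColouredPath

    interiors-disjoint : ∀ {i j} → i ≢ j → ∀ {w} → w ∈ Path.interior (path (colouredPath i)) →
                         w ∉ Path.interior (path (colouredPath j))
    interiors-disjoint {i} {j} i≢j w∈i w∈j = i≢j (just-injective
      (trans (sym (All.lookup (coloured (colouredPath i)) w∈i)) (All.lookup (coloured (colouredPath j)) w∈j)))

    paths-different : ∀ {i j} → i ≢ j →
                      Path.vertices (path (colouredPath i)) ≢ Path.vertices (path (colouredPath j))
    paths-different {i} {j} i≢j eq =
      distinguish _ _ (List.∷ʳ-injectiveˡ _ _ (List.∷-injectiveʳ eq)) refl refl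
      where
      distinguish : ∀ xs ys → xs ≡ ys → Path.interior (path (colouredPath i)) ≡ xs →
                    ¬ (Path.interior (path (colouredPath j)) ≡ ys)
      distinguish [] _ refl eqi eqj =
        i≢j (trans (direct (colouredPath i) eqi) (sym (direct (colouredPath j) eqj)))
      distinguish (x ∷ xs) _ refl eqi eqj =
        interiors-disjoint i≢j (subst (x ∈_) (sym eqi) (here refl)) (subst (x ∈_) (sym eqj) (here refl))

    disjointPaths : ∀ {β} → β ≤ suc K →
      Σ (DisjointPaths G β u v) λ F → ∀ i → length (Path.interior (DisjointPaths.path F i)) ≤ suc n
    disjointPaths β≤ = record
      { path = λ i → path (colouredPath (inject≤ i β≤))
      ; different = λ i j i≢j → paths-different (i≢j ∘ Fin.inject≤-injective β≤ β≤ i j)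
      ; disjoint = λ i j i≢j (w∈i , w∈j) →
          interiors-disjoint (i≢j ∘ Fin.inject≤-injective β≤ β≤ i j) w∈i w∈j
      } , λ i → short (colouredPath (inject≤ i β≤))

  reverseFamily : ∀ {u v K n} → Family u v K n → Family v u K n
  reverseFamily F = record
    { colour = colour ; colour-u = colour-v ; colour-v = colour-u ; member = λ i → Sum.map flipEdge flipRoute (member i) }
    where
    open Family F
    flipEdge : ∀ {A : Set} {u v} → A × u ~ v → A × v ~ u
    flipEdge (a , e) = a , ~-sym e
    flipRoute : ∀ {P u v n} → Route P u v n → Route P v u n
    flipRoute (route e W e′) = route (~-sym e′) (reverse W) (~-sym e)

  weakenFamily : ∀ {u v K m n} → m ≤ n → Family u v K m → Family u v K n
  weakenFamily le F = record
    { colour = colour ; colour-u = colour-u ; colour-v = colour-v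
    ; member = λ i → Sum.map₂ (λ { (route e W e′) → route e (weaken le W) e′ }) (member i) }
    where open Family F

open Walks public

infixr 4 _⟨_⟩_

_⟨_⟩_ : ∀ {G P x y z w m n} → Walk G P x y m → Graph._~_ G y z → Walk G P z w n → Walk G P x w (m + suc n)
_⟨_⟩_ {G} = join G

module _ {G H : Graph} (f : Graph.V G → Graph.V H)
         (hom : ∀ {x y} → Graph._~_ G x y → Graph._~_ H (f x) (f y)) where

  mapWalk : ∀ {P Q x y n} → (∀ z → P z → Q (f z)) → Walk G P x y n → Walk H Q (f x) (f y) n
  mapWalk pres (stop p) = stop (pres _ p)
  mapWalk pres (step p e W) = step (pres _ p) (hom e) (mapWalk pres W)

  mapFamily : (g : Graph.V H → Graph.V G) → (∀ x → g (f x) ≡ x) →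
              ∀ {u v K n} → Family G u v K n → Family H (f u) (f v) K n
  mapFamily g g∘f F = record
    { colour = colour ∘ g
    ; colour-u = trans (cong colour (g∘f _)) colour-u
    ; colour-v = trans (cong colour (g∘f _)) colour-v
    ; member = λ i → Sum.map mapEdge mapRoute (member i) }
    where
    open Family F
    mapEdge : ∀ {A : Set} {x y} → A × Graph._~_ G x y → A × Graph._~_ H (f x) (f y)
    mapEdge (a , e) = a , hom e
    mapRoute : ∀ {i x y n} → Route G (λ w → colour w ≡ i) x y n →
               Route H (λ w → colour (g w) ≡ i) (f x) (f y) n
    mapRoute (route e W e′) =
      route (hom e) (mapWalk (λ z p → trans (cong colour (g∘f z)) p) W) (hom e′)

-- Hamming graphs

Word : ℕ → Set
Word = Vec (Fin 3)

infix 4 _≟_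

_≟_ : ∀ {k} → DecidableEquality (Word k)
_≟_ = Vec.≡-dec Fin._≟_

pick : {P A : Set} → Dec P → A → A → A
pick d x y = if does d then x else y

pick-yes : {P A : Set} (d : Dec P) {x y : A} → P → pick d x y ≡ x
pick-yes d p rewrite dec-true d p = refl

pick-no : {P A : Set} (d : Dec P) {x y : A} → ¬ P → pick d x y ≡ y
pick-no d ¬p rewrite dec-false d ¬p = refl

-- Abstract, so that the compared words can be inferred from a colour.
abstract

  when_is_then_else_ : ∀ {k} {A : Set} → Word k → Word k → A → A → A
  when w is w′ then x else y = pick (w ≟ w′) x y

  when-yes : ∀ {k} {A : Set} {w : Word k} {x y : A} → when w is w then x else y ≡ x
  when-yes {w = w} = pick-yes (w ≟ w) refl

  when-no : ∀ {k} {A : Set} {w w′ : Word k} {x y : A} → w ≢ w′ → when w is w′ then x else y ≡ y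
  when-no {w = w} {w′} = pick-no (w ≟ w′)

  index : ∀ {k K} → (Fin K → Word k) → Word k → Maybe (Fin K)
  index p w with Fin.any? (λ i → p i ≟ w)
  ... | yes (i , _) = just i
  ... | no _ = nothing

  index-hit : ∀ {k K} (p : Fin K → Word k) → (∀ {i j} → p i ≡ p j → i ≡ j) → ∀ i → index p (p i) ≡ just i
  index-hit p inj i with Fin.any? (λ j → p j ≟ p i)
  ... | yes (j , eq) = cong just (inj eq)
  ... | no none = contradiction (i , refl) none

  index-miss : ∀ {k K} (p : Fin K → Word k) {w} → (∀ i → w ≢ p i) → index p w ≡ nothing
  index-miss p {w} miss with Fin.any? (λ i → p i ≟ w)
  ... | yes (i , eq) = contradiction (sym eq) (miss i)
  ... | no _ = refl

Hamming : ℕ → Graph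
Hamming k = record
  { V = Word k ; _~_ = DifferInOne
  ; ~-sym = λ {x} {y} → DifferInOne-sym x y ; ~-irrefl = λ {x} → DifferInOne-irrefl x }

differ-head : ∀ {k a b} {s : Word k} → a ≢ b → DifferInOne (a ∷ s) (b ∷ s)
differ-head a≢b = zero , a≢b , λ { {zero} _ → refl ; {suc _} ne → contradiction refl ne }

differ-tail : ∀ {k a} {s t : Word k} → DifferInOne s t → DifferInOne (a ∷ s) (a ∷ t)
differ-tail (i , ne , uniq) =
  suc i , ne , λ { {zero} ne′ → contradiction refl ne′ ; {suc _} ne′ → cong suc (uniq ne′) }

differ-tail⁻ : ∀ {k a} {s t : Word k} → DifferInOne (a ∷ s) (a ∷ t) → DifferInOne s t
differ-tail⁻ (zero , ne , _) = contradiction refl ne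
differ-tail⁻ (suc i , ne , uniq) = i , ne , λ ne′ → Fin.suc-injective (uniq ne′)

differ-head⁻ : ∀ {k a b} {s t : Word k} → a ≢ b → DifferInOne (a ∷ s) (b ∷ t) → s ≡ t
differ-head⁻ {a = a} {b} {s} {t} a≢b (i , _ , uniq) = same-tail s t agree
  where
  agree : ∀ j → lookup s j ≡ lookup t j
  agree j with lookup s j Fin.≟ lookup t j
  ... | yes eq = eq
  ... | no ne with trans (sym (uniq {zero} a≢b)) (uniq {suc j} ne)
  ...   | ()
  same-tail : ∀ {k} (s t : Word k) → (∀ j → lookup s j ≡ lookup t j) → s ≡ t
  same-tail [] [] _ = refl
  same-tail (_ ∷ s) (_ ∷ t) eq = cong₂ _∷_ (eq zero) (same-tail s t (eq ∘ suc))

differInOne? : ∀ {k} (X Y : Word k) → Dec (DifferInOne X Y)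
differInOne? X Y = Fin.any? λ i → ¬? (lookup X i Fin.≟ lookup Y i) ×-dec
  map′ (λ f {j} → f j) (λ f j → f {j})
       (Fin.all? λ j → ¬? (lookup X j Fin.≟ lookup Y j) →-dec (i Fin.≟ j))

differ⇒≢ : ∀ {k} {x y : Word k} → DifferInOne x y → x ≢ y
differ⇒≢ {x = x} δ refl = DifferInOne-irrefl x δ

Anywhere : ∀ {k} → Word k → Set
Anywhere _ = ⊤

geodesic : ∀ {k} (x y : Word k) → Walk (Hamming k) Anywhere x y k
geodesic [] [] = stop tt
geodesic {suc k} (a ∷ s) (b ∷ t) with a Fin.≟ b
... | yes refl = weaken _ (ℕ.n≤1+n k) (mapWalk (a ∷_) differ-tail _ (geodesic s t))
... | no a≢b = step tt (differ-head a≢b) (mapWalk (b ∷_) differ-tail _ (geodesic s t))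

avoid : (a b : Fin 3) → ∃ λ c → c ≢ a × c ≢ b
avoid 0F 0F = 1F , (λ ()) , λ ()
avoid 0F 1F = 2F , (λ ()) , λ ()
avoid 0F 2F = 1F , (λ ()) , λ ()
avoid 1F 0F = 2F , (λ ()) , λ ()
avoid 1F 1F = 0F , (λ ()) , λ ()
avoid 1F 2F = 0F , (λ ()) , λ ()
avoid 2F 0F = 1F , (λ ()) , λ ()
avoid 2F 1F = 0F , (λ ()) , λ ()
avoid 2F 2F = 0F , (λ ()) , λ ()

neighbour-avoiding : ∀ {k} (x y : Word (suc k)) → ∃ λ x′ → DifferInOne x x′ × x′ ≢ y
neighbour-avoiding (a ∷ s) (b ∷ t) with avoid a b
... | c , c≢a , c≢b = c ∷ s , differ-head (≢-sym c≢a) , λ { refl → c≢b refl }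

record Neighbours {k} (x : Word k) (K : ℕ) : Set where
  field
    pt       : Fin K → Word k
    adjacent : ∀ i → DifferInOne x (pt i)
    inj      : ∀ {i j} → pt i ≡ pt j → i ≡ j

open Neighbours

neighbours : ∀ {k} (x : Word k) → Neighbours x (k * 2)
neighbours [] = record { pt = λ () ; adjacent = λ () ; inj = λ { {()} } }
neighbours {suc k} (a ∷ s) with avoid a a
... | b , b≢a , _ with avoid a b
...   | c , c≢a , c≢b = record { pt = p ; adjacent = adj ; inj = p-inj _ _ }
  where
  N = neighbours s
  p : Fin (2 + k * 2) → Word (suc k)
  p 0F = b ∷ s
  p 1F = c ∷ s
  p (suc (suc i)) = a ∷ pt N i
  adj : ∀ i → DifferInOne (a ∷ s) (p i)
  adj 0F = differ-head (≢-sym b≢a)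
  adj 1F = differ-head (≢-sym c≢a)
  adj (suc (suc i)) = differ-tail (adjacent N i)
  p-inj : ∀ i j → p i ≡ p j → i ≡ j
  p-inj 0F 0F _ = refl
  p-inj 0F 1F eq = contradiction (sym (Vec.∷-injectiveˡ eq)) c≢b
  p-inj 0F (suc (suc _)) eq = contradiction (Vec.∷-injectiveˡ eq) b≢a
  p-inj 1F 0F eq = contradiction (Vec.∷-injectiveˡ eq) c≢b
  p-inj 1F 1F _ = refl
  p-inj 1F (suc (suc _)) eq = contradiction (Vec.∷-injectiveˡ eq) c≢a
  p-inj (suc (suc _)) 0F eq = contradiction (sym (Vec.∷-injectiveˡ eq)) b≢a
  p-inj (suc (suc _)) 1F eq = contradiction (sym (Vec.∷-injectiveˡ eq)) c≢a
  p-inj (suc (suc i)) (suc (suc j)) eq = cong (λ i → suc (suc i)) (inj N (Vec.∷-injectiveʳ eq))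

restrict : ∀ {k} {x : Word k} {K K′} → K ≤ K′ → Neighbours x K′ → Neighbours x K
restrict le N = record
  { pt = λ i → pt N (inject≤ i le)
  ; adjacent = λ i → adjacent N (inject≤ i le)
  ; inj = λ eq → Fin.inject≤-injective le le _ _ (inj N eq) }

anchor : ∀ {k} {x z : Word k} {K} → DifferInOne x z → Neighbours x (suc K) →
         Σ (Neighbours x (suc K)) λ N → pt N zero ≡ z
anchor {k} {x} {z} {K} δ N = record { pt = p ; adjacent = adj ; inj = p-inj _ _ } , refl
  where
  p : Fin (suc K) → Word k
  p zero = z
  p (suc i) = pick (pt N (suc i) ≟ z) (pt N zero) (pt N (suc i))
  adj : ∀ i → DifferInOne x (p i)
  adj zero = δ
  adj (suc i) with does (pt N (suc i) ≟ z)
  ... | true = adjacent N zero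
  ... | false = adjacent N (suc i)
  other : ∀ i → z ≢ p (suc i)
  other i eq with pt N (suc i) ≟ z
  ... | yes eq′ = contradiction (inj N (trans (sym eq) (sym eq′))) λ ()
  ... | no ne = ne (sym eq)
  p-inj : ∀ i j → p i ≡ p j → i ≡ j
  p-inj zero zero _ = refl
  p-inj zero (suc j) eq = contradiction eq (other j)
  p-inj (suc i) zero eq = contradiction (sym eq) (other i)
  p-inj (suc i) (suc j) eq with pt N (suc i) ≟ z | pt N (suc j) ≟ z
  ... | yes eqi | yes eqj = inj N (trans eqi (sym eqj))
  ... | yes _ | no _ = contradiction (inj N eq) λ ()
  ... | no _ | yes _ = contradiction (inj N eq) λ ()
  ... | no _ | no _ = inj N eq

record Approach {k} (x y : Word k) (n : ℕ) : Set where
  field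
    {gate}   : Word k
    gate~y   : DifferInOne y gate
    approach : Walk (Hamming k) (λ z → z ≢ y × (DifferInOne y z → z ≡ gate)) x gate n

approach : ∀ {k} (x y : Word (suc k)) → x ≢ y → Approach x y k
approach {k} (a ∷ s) (b ∷ t) x≢y with s ≟ t
... | yes refl = record { gate~y = differ-head (λ { refl → x≢y refl }) ; approach = stop (x≢y , λ _ → refl) }
approach {zero} (a ∷ []) (b ∷ []) x≢y | no s≢t = contradiction refl s≢t
approach {suc k} (a ∷ s) (b ∷ t) x≢y | no s≢t with approach s t s≢t
... | record { gate = g ; gate~y = g~t ; approach = W } = record { gate~y = differ-tail g~t ; approach = towards }
  where
  Near : Word (suc (suc k)) → Set
  Near z = z ≢ b ∷ t × (DifferInOne (b ∷ t) z → z ≡ b ∷ g)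
  W′ : Walk (Hamming (suc (suc k))) Near (b ∷ s) (b ∷ g) k
  W′ = mapWalk (b ∷_) differ-tail
         (λ { z (z≢t , near) → (z≢t ∘ Vec.∷-injectiveʳ) , λ δ → cong (b ∷_) (near (differ-tail⁻ δ)) }) W
  towards : Walk (Hamming (suc (suc k))) Near (a ∷ s) (b ∷ g) (suc k)
  towards with a Fin.≟ b
  ... | yes refl = weaken _ (ℕ.n≤1+n k) W′
  ... | no a≢b = step (x≢y , λ δ → contradiction (sym (differ-head⁻ (≢-sym a≢b) δ)) s≢t) (differ-head a≢b) W′

spread : ∀ {K} → Fin (suc K) → Fin (3 + K)
spread zero = zero
spread (suc i) = suc (suc (suc i))

fan-heads-agree : ∀ {k K} a {s t : Word k} → Family (Hamming k) s t K k →
                  Family (Hamming (suc k)) (a ∷ s) (a ∷ t) (2 + K) k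
fan-heads-agree {k} {K} a {s} {t} F with avoid a a
... | b , b≢a , _ with avoid a b
...   | c , c≢a , c≢b = record
  { colour = col
  ; colour-u = inside colour-u ; colour-v = inside colour-v
  ; member = λ where
      0F → Sum.map (λ (_ , e) → refl , differ-tail e) lift (member 0F)
      1F → inj₂ (parallel b≢a λ z → trans (pick-no (b Fin.≟ a) b≢a) (pick-yes (b Fin.≟ b) refl))
      2F → inj₂ (parallel c≢a λ z → trans (pick-no (c Fin.≟ a) c≢a) (pick-no (c Fin.≟ b) c≢b))
      (suc (suc (suc i))) → Sum.map (λ ()) lift (member (suc i)) }
  where
  open Family F
  col : Word (suc k) → Maybe (Fin (3 + K))
  col (h ∷ z) = pick (h Fin.≟ a) (Maybe.map spread (colour z)) (pick (h Fin.≟ b) (just 1F) (just 2F))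
  inside : ∀ {z c} → colour z ≡ c → col (a ∷ z) ≡ Maybe.map spread c
  inside eq = trans (pick-yes (a Fin.≟ a) refl) (cong (Maybe.map spread) eq)
  lift : ∀ {i} → Route (Hamming k) (λ w → colour w ≡ just i) s t k →
         Route (Hamming (suc k)) (λ w → col w ≡ just (spread i)) (a ∷ s) (a ∷ t) k
  lift (route e W e′) = route (differ-tail e) (mapWalk (a ∷_) differ-tail (λ _ → inside) W) (differ-tail e′)
  parallel : ∀ {h i} → h ≢ a → (∀ z → col (h ∷ z) ≡ just i) →
             Route (Hamming (suc k)) (λ w → col w ≡ just i) (a ∷ s) (a ∷ t) k
  parallel {h} h≢a eq = route (differ-head (≢-sym h≢a))
    (mapWalk (h ∷_) differ-tail (λ z _ → eq z) (geodesic s t)) (differ-head h≢a)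

fan-tails-agree : ∀ {k n} {a b} (s : Word k) → a ≢ b → (Fin (k * 2) → 1 ≤ n) →
                  Family (Hamming (suc k)) (a ∷ s) (b ∷ s) (suc (k * 2)) n
fan-tails-agree {k} {n} {a} {b} s a≢b long with avoid a b
... | c , c≢a , c≢b = record
  { colour = col
  ; colour-u = trans (on-tail a) (pick-no (a Fin.≟ c) (≢-sym c≢a))
  ; colour-v = trans (on-tail b) (pick-no (b Fin.≟ c) (≢-sym c≢b))
  ; member = λ where
      0F → inj₁ (refl , differ-head a≢b)
      1F → inj₂ (route (differ-head (≢-sym c≢a)) (stop (trans (on-tail c) (pick-yes (c Fin.≟ c) refl)))
                       (differ-head c≢b))
      (suc (suc i)) → inj₂ (route {first = a ∷ pt N i} {b ∷ pt N i} (differ-tail (adjacent N i))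
                             (weaken _ (long i) (step (off-tail a i) (differ-head a≢b) (stop {n = 0} (off-tail b i))))
                             (differ-tail (DifferInOne-sym s (pt N i) (adjacent N i)))) }
  where
  N = neighbours s
  col : Word (suc k) → Maybe (Fin (2 + k * 2))
  col (h ∷ z) = pick (z ≟ s) (pick (h Fin.≟ c) (just 1F) nothing)
                             (Maybe.map (λ i → suc (suc i)) (index (pt N) z))
  on-tail : ∀ h → col (h ∷ s) ≡ pick (h Fin.≟ c) (just 1F) nothing
  on-tail h = pick-yes (s ≟ s) refl
  off-tail : ∀ h i → col (h ∷ pt N i) ≡ just (suc (suc i))
  off-tail h i = trans (pick-no (pt N i ≟ s) (≢-sym (differ⇒≢ (adjacent N i))))
                     (cong (Maybe.map (λ i → suc (suc i))) (index-hit (pt N) (inj N) i))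

-- The first tail route is used twice, once behind each of the two heads.
fan-both-differ : ∀ {k K} {a b} {s t : Word (suc k)} → a ≢ b → s ≢ t → Family (Hamming (suc k)) s t K k →
                  Family (Hamming (2 + k)) (a ∷ s) (b ∷ t) (2 + K) (suc k)
fan-both-differ {k} {K} {a} {b} {s} {t} a≢b s≢t F with avoid a b
... | c , c≢a , c≢b = record
  { colour = col
  ; colour-u = col-as
  ; colour-v = col-bt
  ; member = λ where
      0F → inj₂ (low (member 0F))
      1F → inj₂ (high (member 0F))
      2F → inj₂ (route (differ-head (≢-sym c≢a))
             (mapWalk (c ∷_) differ-tail (λ _ _ → pick-yes (c Fin.≟ c) refl) (geodesic s t)) (differ-head c≢b))
      (suc (suc (suc i))) → inj₂ (cross i (member (suc i))) }
  where
  open Family F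
  G = Hamming (2 + k)
  byTail : Fin 3 → Word (suc k) → Maybe (Fin (suc K)) → Maybe (Fin (3 + K))
  byTail h z (just (suc i)) = just (suc (suc (suc i)))
  byTail h z (just zero) = pick (h Fin.≟ a) (just 1F) (just 0F)
  byTail h z nothing = pick (z ≟ s) (pick (h Fin.≟ a) nothing (just 0F)) (pick (h Fin.≟ a) (just 1F) nothing)
  col : Word (2 + k) → Maybe (Fin (3 + K))
  col (h ∷ z) = pick (h Fin.≟ c) (just 2F) (byTail h z (colour z))
  behind-a : ∀ {z m} → colour z ≡ m → col (a ∷ z) ≡ byTail a z m
  behind-a {z} eq = trans (pick-no (a Fin.≟ c) (≢-sym c≢a)) (cong (byTail a z) eq)
  behind-b : ∀ {z m} → colour z ≡ m → col (b ∷ z) ≡ byTail b z m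
  behind-b {z} eq = trans (pick-no (b Fin.≟ c) (≢-sym c≢b)) (cong (byTail b z) eq)
  b≢a = ≢-sym a≢b
  t≢s = ≢-sym s≢t
  col-as : col (a ∷ s) ≡ nothing
  col-as = trans (behind-a colour-u) (trans (pick-yes (s ≟ s) refl) (pick-yes (a Fin.≟ a) refl))
  col-bs : col (b ∷ s) ≡ just 0F
  col-bs = trans (behind-b colour-u) (trans (pick-yes (s ≟ s) refl) (pick-no (b Fin.≟ a) b≢a))
  col-at : col (a ∷ t) ≡ just 1F
  col-at = trans (behind-a colour-v) (trans (pick-no (t ≟ s) t≢s) (pick-yes (a Fin.≟ a) refl))
  col-bt : col (b ∷ t) ≡ nothing
  col-bt = trans (behind-b colour-v) (trans (pick-no (t ≟ s) t≢s) (pick-no (b Fin.≟ a) b≢a))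
  low : _ ⊎ Route (Hamming (suc k)) (λ w → colour w ≡ just 0F) s t k →
        Route G (λ w → col w ≡ just 0F) (a ∷ s) (b ∷ t) (suc k)
  low (inj₁ (_ , e)) = route (differ-head a≢b) (stop col-bs) (differ-tail e)
  low (inj₂ (route e W e′)) = route (differ-head a≢b)
    (step col-bs (differ-tail e)
      (mapWalk (b ∷_) differ-tail (λ _ eq → trans (behind-b eq) (pick-no (b Fin.≟ a) b≢a)) W))
    (differ-tail e′)
  high : _ ⊎ Route (Hamming (suc k)) (λ w → colour w ≡ just 0F) s t k →
         Route G (λ w → col w ≡ just 1F) (a ∷ s) (b ∷ t) (suc k)
  high (inj₁ (_ , e)) = route (differ-tail e) (stop col-at) (differ-head a≢b)
  high (inj₂ (route e W e′)) = route (differ-tail e)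
    (subst (Walk G _ _ _) (ℕ.+-comm k 1)
      (join G (mapWalk (a ∷_) differ-tail (λ _ eq → trans (behind-a eq) (pick-yes (a Fin.≟ a) refl)) W)
             (differ-tail e′) (stop {n = 0} col-at)))
    (differ-head a≢b)
  cross : ∀ i → (suc i ≡ zero × _) ⊎ Route (Hamming (suc k)) (λ w → colour w ≡ just (suc i)) s t k →
          Route G (λ w → col w ≡ just (suc (suc (suc i)))) (a ∷ s) (b ∷ t) (suc k)
  cross i (inj₁ (() , _))
  cross i (inj₂ (route e W e′)) = route (differ-tail e)
    (subst (Walk G _ _ _) (ℕ.+-comm k 1)
      (join G (mapWalk (a ∷_) differ-tail (λ _ → behind-a) W)
             (differ-head a≢b) (stop {n = 0} (behind-b (ends _ W)))))
    (differ-tail e′)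

fan : ∀ {k} (x y : Word (suc k)) → x ≢ y → Family (Hamming (suc k)) x y (suc (k * 2)) k
fan (a ∷ s) (b ∷ t) x≢y with a Fin.≟ b | s ≟ t
... | yes refl | yes refl = contradiction refl x≢y
fan {zero} (a ∷ []) (b ∷ []) x≢y | no a≢b | yes refl = fan-tails-agree [] a≢b λ ()
fan {suc k} (a ∷ s) (b ∷ s) x≢y | no a≢b | yes refl = fan-tails-agree s a≢b λ _ → s≤s z≤n
fan {zero} (a ∷ []) (b ∷ []) x≢y | _ | no s≢t = contradiction refl s≢t
fan {suc k} (a ∷ s) (b ∷ t) x≢y | yes refl | no s≢t =
  fan-heads-agree a (weakenFamily _ (ℕ.n≤1+n k) (fan s t s≢t))
fan {suc k} (a ∷ s) (b ∷ t) x≢y | no a≢b | no s≢t = fan-both-differ a≢b s≢t (fan s t s≢t)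

fan-around : ∀ {k K n} {x : Word k} → Neighbours x (suc K) → Family (Hamming k) x x K n
fan-around {x = x} N = record
  { colour = index (pt N)
  ; colour-u = index-miss (pt N) λ i → differ⇒≢ (adjacent N i)
  ; colour-v = index-miss (pt N) λ i → differ⇒≢ (adjacent N i)
  ; member = λ i → inj₂ (route (adjacent N i) (stop (index-hit (pt N) (inj N) i))
                               (DifferInOne-sym x (pt N i) (adjacent N i))) }

-- End vertices in the same layer

module Axes (n₀ n₁ n₂ : ℕ) where

  E : Graph
  E = E3C n₂ n₁ n₀

  open Graph E public using (V; _~_)

  line₀ : ∀ {P b c} a a′ → (∀ z → P (c , b , z , 0F)) → Walk E P (c , b , a , 0F) (c , b , a′ , 0F) n₀
  line₀ a a′ p = mapWalk (λ z → _ , _ , z , 0F) E1 (λ z _ → p z) (geodesic a a′)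

  line₁ : ∀ {P a c} b b′ → (∀ z → P (c , z , a , 1F)) → Walk E P (c , b , a , 1F) (c , b′ , a , 1F) n₁
  line₁ b b′ p = mapWalk (λ z → _ , z , _ , 1F) E2 (λ z _ → p z) (geodesic b b′)

  line₂ : ∀ {P a b} c c′ → (∀ z → P (z , b , a , 2F)) → Walk E P (c , b , a , 2F) (c′ , b , a , 2F) n₂
  line₂ c c′ p = mapWalk (λ z → z , _ , _ , 2F) E3 (λ z _ → p z) (geodesic c c′)

  at : ∀ {P : V → Set} {w} → P w → Walk E P w w 0
  at = stop

  two : ∀ {P : V → Set} {w w′} → P w → w ~ w′ → P w′ → Walk E P w w′ 1
  two p e p′ = step p e (stop p′)

  turn : ∀ {A B C d d′} {d≢d′ : True (¬? (d Fin.≟ d′))} → (A , B , C , d) ~ (A , B , C , d′)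
  turn {d≢d′ = d≢d′} = E0 (toWitness d≢d′)

  fit : ∀ {P x y m n} → Walk E P x y m → ∀ k → m + k ≡ n → Walk E P x y n
  fit W k eq = weaken _ (subst (_ ≤_) eq (ℕ.m≤m+n _ k)) W


module SameLayer {k₀ k₁ k₂ : ℕ} where

  open Axes (suc k₀) (suc k₁) (suc k₂) public

  through : ∀ {P Q x₀ y₀ x₁ x₂} y₁ y₂ → Route (Hamming (suc k₀)) Q x₀ y₀ k₀ →
            (∀ a → Q a → P (x₂ , x₁ , a , 0F)) → (∀ a b → Q a → P (x₂ , b , a , 1F)) →
            (∀ a c → Q a → P (c , y₁ , a , 2F)) → (∀ a → Q a → P (y₂ , y₁ , a , 0F)) →
            Route E P (x₂ , x₁ , x₀ , 0F) (y₂ , y₁ , y₀ , 0F) (suc k₀ + suc k₁ + suc k₂ + 4)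
  through {x₁ = x₁} {x₂} y₁ y₂ (route {e} {f} x~e W f~y) p₀ p₁ p₂ p₃ = route (E1 x~e)
    (fit
      (at (p₀ e (starts _ W)) ⟨ turn ⟩ line₁ x₁ y₁ (λ b → p₁ e b (starts _ W)) ⟨ turn ⟩
       line₂ x₂ y₂ (λ c → p₂ e c (starts _ W)) ⟨ turn ⟩ mapWalk (λ a → y₂ , y₁ , a , 0F) E1 p₃ W)
      2 (solve (k₀ L.∷ k₁ L.∷ k₂ L.∷ L.[])))
    (E1 f~y)

  orElse : ∀ {K} → Maybe (Fin (3 + K)) → Maybe (Fin (suc K)) → Maybe (Fin (3 + K))
  orElse = maybe′ (just ∘ spread)

  module _ {K} {x₀ y₀ : Word (suc k₀)} (F : Family (Hamming (suc k₀)) x₀ y₀ K k₀) where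
    open Family F using () renaming (colour to fcol; colour-u to fcol-x; colour-v to fcol-y; member to fan-member)

    far-apart : ∀ {x₁ y₁ x₂ y₂} → (DifferInOne x₀ y₀ → x₁ ≡ y₁ × x₂ ≡ y₂) →
                Family E (x₂ , x₁ , x₀ , 0F) (y₂ , y₁ , y₀ , 0F) (2 + K) (suc k₀ + suc k₁ + suc k₂ + 4)
    far-apart {x₁} {y₁} {x₂} {y₂} aligned with neighbour-avoiding y₁ x₁ | neighbour-avoiding x₂ y₂
    ... | b′ , y₁~b′ , b′≢x₁ | c′ , x₂~c′ , c′≢y₂ = record
      { colour = col
      ; colour-u = col-fan₀ (differ⇒≢ x₂~c′) (≢-sym b′≢x₁) fcol-x
      ; colour-v = col-fan₀ (≢-sym c′≢y₂) (differ⇒≢ y₁~b′) fcol-y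
      ; member = λ where
          0F → Sum.map (λ (_ , e) → refl , edge e (aligned e)) fan-route (fan-member 0F)
          1F → inj₂ (route turn
                 (fit
                   (line₁ x₁ b′ (λ b → col-fan₁ b (differ⇒≢ x₂~c′) fcol-x) ⟨ turn ⟩
                    line₂ x₂ y₂ (λ c → trans (cong (orElse _) fcol-x) when-yes) ⟨ turn ⟩
                    line₀ x₀ y₀ (λ a → trans (when-no (≢-sym c′≢y₂)) when-yes) ⟨ turn ⟩
                    two (col-fan₁ b′ (≢-sym c′≢y₂) fcol-y) (E2 (DifferInOne-sym y₁ b′ y₁~b′))
                        (col-fan₁ y₁ (≢-sym c′≢y₂) fcol-y))
                   0 (solve (k₀ L.∷ k₁ L.∷ k₂ L.∷ L.[])))
                 turn)
          2F → inj₂ (route turn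
                 (fit
                   (two (col-2F x₂ (≢-sym b′≢x₁) fcol-x) (E3 x₂~c′) (col-2F c′ (≢-sym b′≢x₁) fcol-x) ⟨ turn ⟩
                    line₀ x₀ y₀ (λ a → when-yes) ⟨ turn ⟩
                    line₁ x₁ y₁ (λ b → when-yes) ⟨ turn ⟩
                    line₂ c′ y₂ (λ c → col-2F c (differ⇒≢ y₁~b′) fcol-y))
                   0 (solve (k₀ L.∷ k₁ L.∷ k₂ L.∷ L.[])))
                 turn)
          (suc (suc (suc i))) → Sum.map (λ ()) fan-route (fan-member (suc i)) }
      where
      col : V → Maybe (Fin (3 + K))
      col (c , b , a , 0F) = when c is c′ then just 2F else when b is b′ then just 1F else orElse nothing (fcol a)
      col (c , b , a , 1F) = when c is c′ then just 2F else orElse (just 1F) (fcol a)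
      col (c , b , a , 2F) = orElse (when b is b′ then just 1F else just 2F) (fcol a)
      col-fan₀ : ∀ {a b c m} → c ≢ c′ → b ≢ b′ → fcol a ≡ m → col (c , b , a , 0F) ≡ orElse nothing m
      col-fan₀ c≢ b≢ eq =
        trans (when-no c≢) (trans (when-no b≢) (cong (orElse nothing) eq))
      col-fan₁ : ∀ {a c m} b → c ≢ c′ → fcol a ≡ m → col (c , b , a , 1F) ≡ orElse (just 1F) m
      col-fan₁ _ c≢ eq = trans (when-no c≢) (cong (orElse (just 1F)) eq)
      col-2F : ∀ {a b} c → b ≢ b′ → fcol a ≡ nothing → col (c , b , a , 2F) ≡ just 2F
      col-2F _ b≢ eq = trans (cong (orElse _) eq) (when-no b≢)
      edge : DifferInOne x₀ y₀ → x₁ ≡ y₁ × x₂ ≡ y₂ → (x₂ , x₁ , x₀ , 0F) ~ (y₂ , y₁ , y₀ , 0F)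
      edge e (refl , refl) = E1 e
      fan-route : ∀ {i} → Route (Hamming (suc k₀)) (λ a → fcol a ≡ just i) x₀ y₀ k₀ →
                  Route E (λ w → col w ≡ just (spread i)) (x₂ , x₁ , x₀ , 0F) (y₂ , y₁ , y₀ , 0F)
                        (suc k₀ + suc k₁ + suc k₂ + 4)
      fan-route R = through y₁ y₂ R
        (λ _ → col-fan₀ (differ⇒≢ x₂~c′) (≢-sym b′≢x₁)) (λ _ b → col-fan₁ b (differ⇒≢ x₂~c′))
        (λ _ _ → cong (orElse _)) (λ _ → col-fan₀ (≢-sym c′≢y₂) (differ⇒≢ y₁~b′))

    overlay : (V → Maybe (Fin (3 + K))) → V → Maybe (Fin (3 + K))
    overlay base w@(_ , _ , a , _) = orElse (base w) (fcol a)

    on-x : ∀ {m} → orElse m (fcol x₀) ≡ m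
    on-x {m} = cong (orElse m) fcol-x

    on-y : ∀ {m} → orElse m (fcol y₀) ≡ m
    on-y {m} = cong (orElse m) fcol-y

    overlay-route : ∀ {x₁ y₁ x₂ y₂ i} base → Route (Hamming (suc k₀)) (λ a → fcol a ≡ just i) x₀ y₀ k₀ →
                    Route E (λ w → overlay base w ≡ just (spread i)) (x₂ , x₁ , x₀ , 0F) (y₂ , y₁ , y₀ , 0F)
                          (suc k₀ + suc k₁ + suc k₂ + 4)
    overlay-route {y₁ = y₁} {y₂ = y₂} base R =
      through y₁ y₂ R (λ _ → cong (orElse _)) (λ _ _ → cong (orElse _))
                      (λ _ _ → cong (orElse _)) (λ _ → cong (orElse _))

    close : ∀ {x₁ y₁ x₂ y₂} → DifferInOne x₀ y₀ → x₁ ≢ y₁ → x₂ ≢ y₂ →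
            Family E (x₂ , x₁ , x₀ , 0F) (y₂ , y₁ , y₀ , 0F) (2 + K) (suc k₀ + suc k₁ + suc k₂ + 4)
    close {x₁} {y₁} {x₂} {y₂} x₀~y₀ x₁≢y₁ x₂≢y₂ = record
      { colour = overlay base
      ; colour-u = trans on-x (trans when-yes (trans (when-no x₂≢y₂) when-yes))
      ; colour-v = trans on-y (trans (when-no y₁≢x₁) (when-no y₀≢x₀))
      ; member = λ where
          0F → inj₂ (route turn
                 (fit
                   (line₁ x₁ y₁ (λ b → trans on-x (trans when-yes when-yes)) ⟨ turn ⟩
                    line₂ x₂ y₂ (λ c → trans on-x (trans (when-no x₀≢y₀) when-yes)) ⟨ turn ⟩
                    at (trans on-x (trans (when-no y₁≢x₁) when-yes)))
                   (3 + k₀) (solve (k₀ L.∷ k₁ L.∷ k₂ L.∷ L.[])))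
                 (E1 x₀~y₀))
          1F → inj₂ (route (E1 x₀~y₀)
                 (fit
                   (at (trans on-y (trans when-yes (trans (when-no x₂≢y₂) (when-no y₀≢x₀)))) ⟨ turn ⟩
                    line₁ x₁ y₁ (λ b → trans on-y (trans when-yes (when-no y₀≢x₀))) ⟨ turn ⟩
                    line₂ x₂ y₂ (λ c → trans on-y when-yes))
                   (3 + k₀) (solve (k₀ L.∷ k₁ L.∷ k₂ L.∷ L.[])))
                 turn)
          2F → inj₂ (route turn
                 (fit
                   (line₂ x₂ y₂ (λ c → trans on-x (trans (when-no x₀≢y₀) (when-no x₁≢y₁))) ⟨ turn ⟩
                    two (trans on-x (trans when-yes when-yes)) (E1 x₀~y₀)
                        (trans on-y (trans when-yes when-yes)) ⟨ turn ⟩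
                    line₁ x₁ y₁ (λ b → trans on-y (when-no (≢-sym x₂≢y₂))))
                   (2 + k₀) (solve (k₀ L.∷ k₁ L.∷ k₂ L.∷ L.[])))
                 turn)
          (suc (suc (suc i))) → Sum.map (λ ()) (overlay-route base) (fan-member (suc i)) }
      where
      x₀≢y₀ : x₀ ≢ y₀
      x₀≢y₀ = differ⇒≢ x₀~y₀
      y₀≢x₀ = ≢-sym x₀≢y₀
      y₁≢x₁ = ≢-sym x₁≢y₁
      base : V → Maybe (Fin (3 + K))
      base (c , b , a , 0F) = when b is x₁
        then when c is y₂ then just 2F else when a is x₀ then nothing else just 1F
        else when a is x₀ then just 0F else nothing
      base (c , b , a , 1F) = when c is x₂ then when a is x₀ then just 0F else just 1F else just 2F
      base (c , b , a , 2F) = when a is y₀ then just 1F else when b is y₁ then just 0F else just 2F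

    close-level : ∀ {x₁ x₂ y₂} → DifferInOne x₀ y₀ → x₂ ≢ y₂ →
                  Family E (x₂ , x₁ , x₀ , 0F) (y₂ , x₁ , y₀ , 0F) (2 + K) (suc k₀ + suc k₁ + suc k₂ + 4)
    close-level {x₁} {x₂} {y₂} x₀~y₀ x₂≢y₂ with neighbour-avoiding x₁ x₁
    ... | b′ , x₁~b′ , b′≢x₁ = record
      { colour = overlay base
      ; colour-u = trans on-x (trans when-yes (trans when-yes when-yes))
      ; colour-v = trans on-y (trans when-yes (trans (when-no y₂≢x₂) (when-no y₀≢x₀)))
      ; member = λ where
          0F → inj₂ (route turn
                 (fit
                   (line₂ x₂ y₂ (λ c → trans on-x (trans when-yes when-yes)) ⟨ turn ⟩
                    at (trans on-x (trans when-yes (trans (when-no y₂≢x₂) when-yes))))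
                   (5 + k₀ + k₁) (solve (k₀ L.∷ k₁ L.∷ k₂ L.∷ L.[])))
                 (E1 x₀~y₀))
          1F → inj₂ (route (E1 x₀~y₀)
                 (fit
                   (at (trans on-y (trans when-yes (trans when-yes (when-no y₀≢x₀)))) ⟨ turn ⟩
                    line₂ x₂ y₂ (λ c → trans on-y (trans when-yes (when-no y₀≢x₀))))
                   (5 + k₀ + k₁) (solve (k₀ L.∷ k₁ L.∷ k₂ L.∷ L.[])))
                 turn)
          2F → inj₂ (route turn
                 (fit
                   (two on-x (E2 x₁~b′) on-x ⟨ turn ⟩
                    line₂ x₂ y₂ (λ c → trans on-x (when-no b′≢x₁)) ⟨ turn ⟩
                    two (trans on-x (when-no b′≢x₁)) (E1 x₀~y₀) (trans on-y (when-no b′≢x₁)) ⟨ turn ⟩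
                    two on-y (E2 (DifferInOne-sym x₁ b′ x₁~b′)) on-y)
                   (k₀ + k₁) (solve (k₀ L.∷ k₁ L.∷ k₂ L.∷ L.[])))
                 turn)
          (suc (suc (suc i))) → Sum.map (λ ()) (overlay-route base) (fan-member (suc i)) }
      where
      y₀≢x₀ : y₀ ≢ x₀
      y₀≢x₀ = ≢-sym (differ⇒≢ x₀~y₀)
      y₂≢x₂ = ≢-sym x₂≢y₂
      base : V → Maybe (Fin (3 + K))
      base (c , b , a , 0F) = when b is x₁
        then when c is x₂ then when a is x₀ then nothing else just 1F
                          else when a is x₀ then just 0F else nothing
        else just 2F
      base (c , b , a , 1F) = just 2F
      base (c , b , a , 2F) = when b is x₁ then when a is x₀ then just 0F else just 1F else just 2F

    over : ∀ {x₁ y₁ x₂ y₂} → x₀ ≡ y₀ → x₁ ≢ y₁ → x₂ ≢ y₂ →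
           Family E (x₂ , x₁ , x₀ , 0F) (y₂ , y₁ , y₀ , 0F) (2 + K) (suc k₀ + suc k₁ + suc k₂ + 4)
    over {x₁} {y₁} {x₂} {y₂} refl x₁≢y₁ x₂≢y₂ = record
      { colour = overlay base
      ; colour-u = on-x
      ; colour-v = on-x
      ; member = λ where
          0F → Sum.map (λ (_ , e) → contradiction e (DifferInOne-irrefl x₀)) (overlay-route base) (fan-member 0F)
          1F → inj₂ (route turn
                 (fit
                   (line₁ x₁ y₁ (λ b → trans on-x when-yes) ⟨ turn ⟩
                    line₂ x₂ y₂ (λ c → trans on-x when-yes))
                   (4 + k₀) (solve (k₀ L.∷ k₁ L.∷ k₂ L.∷ L.[])))
                 turn)
          2F → inj₂ (route turn
                 (fit
                   (line₂ x₂ y₂ (λ c → trans on-x (when-no x₁≢y₁)) ⟨ turn ⟩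
                    line₁ x₁ y₁ (λ b → trans on-x (when-no (≢-sym x₂≢y₂))))
                   (4 + k₀) (solve (k₀ L.∷ k₁ L.∷ k₂ L.∷ L.[])))
                 turn)
          (suc (suc (suc i))) → Sum.map (λ ()) (overlay-route base) (fan-member (suc i)) }
      where
      base : V → Maybe (Fin (3 + K))
      base (c , b , a , 0F) = nothing
      base (c , b , a , 1F) = when c is x₂ then just 1F else just 2F
      base (c , b , a , 2F) = when b is y₁ then just 1F else just 2F

    over-level : ∀ {x₁ x₂ y₂} → x₀ ≡ y₀ →
                 Family E (x₂ , x₁ , x₀ , 0F) (y₂ , x₁ , y₀ , 0F) (2 + K) (suc k₀ + suc k₁ + suc k₂ + 4)
    over-level {x₁} {x₂} {y₂} refl with neighbour-avoiding x₁ x₁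
    ... | b′ , x₁~b′ , b′≢x₁ = record
      { colour = overlay base
      ; colour-u = on-x
      ; colour-v = on-x
      ; member = λ where
          0F → Sum.map (λ (_ , e) → contradiction e (DifferInOne-irrefl x₀)) (overlay-route base) (fan-member 0F)
          1F → inj₂ (route turn
                 (fit (line₂ x₂ y₂ (λ c → trans on-x when-yes)) (6 + k₀ + k₁) (solve (k₀ L.∷ k₁ L.∷ k₂ L.∷ L.[])))
                 turn)
          2F → inj₂ (route turn
                 (fit
                   (two on-x (E2 x₁~b′) on-x ⟨ turn ⟩
                    line₂ x₂ y₂ (λ c → trans on-x (when-no b′≢x₁)) ⟨ turn ⟩
                    two on-x (E2 (DifferInOne-sym x₁ b′ x₁~b′)) on-x)
                   (2 + k₀ + k₁) (solve (k₀ L.∷ k₁ L.∷ k₂ L.∷ L.[])))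
                 turn)
          (suc (suc (suc i))) → Sum.map (λ ()) (overlay-route base) (fan-member (suc i)) }
      where
      base : V → Maybe (Fin (3 + K))
      base (c , b , a , 0F) = nothing
      base (c , b , a , 1F) = just 2F
      base (c , b , a , 2F) = when b is x₁ then just 1F else just 2F

-- End vertices in different layers

label : ∀ {k K} {x : Word k} → Fin (3 + K) → Neighbours x (suc K) → Word k → Fin (3 + K)
label o N w = maybe′ (λ i → suc (suc (suc i))) o (index (λ i → pt N (suc i)) w)

module _ {k K} {x : Word k} {o : Fin (3 + K)} (N : Neighbours x (suc K)) where

  label-hit : ∀ i → label o N (pt N (suc i)) ≡ suc (suc (suc i))
  label-hit i = cong (maybe′ _ o) (index-hit _ (Fin.suc-injective ∘ inj N) i)

  label-miss : ∀ {w} → (∀ i → w ≢ pt N (suc i)) → label o N w ≡ o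
  label-miss miss = cong (maybe′ _ o) (index-miss _ miss)

  label-anchor : label o N (pt N zero) ≡ o
  label-anchor = label-miss λ i eq → contradiction (inj N eq) λ ()

pt≢centre : ∀ {k K} {x : Word k} (N : Neighbours x K) i → pt N i ≢ x
pt≢centre N i = ≢-sym (differ⇒≢ (adjacent N i))

adjacent-sym : ∀ {k K} {x : Word k} (N : Neighbours x K) i → DifferInOne (pt N i) x
adjacent-sym {x = x} N i = DifferInOne-sym x (pt N i) (adjacent N i)

OnApproach : ∀ {k K} {x : Word k} → Neighbours x (suc K) → Word k → Set
OnApproach {x = x} N z = z ≢ x × (DifferInOne x z → z ≡ pt N zero)

approach-misses : ∀ {k K} {x z : Word k} (N : Neighbours x (suc K)) → OnApproach N z → ∀ i → z ≢ pt N (suc i)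
approach-misses N (_ , near) i refl = contradiction (inj N (near (adjacent N (suc i)))) λ ()

module AcrossLayers {k₀ k₁ k₂ K : ℕ} {x₀ : Word (suc k₀)} {y₁ : Word (suc k₁)}
                    (N : Neighbours x₀ (suc K)) (M : Neighbours y₁ (suc K)) where

  open Axes (suc k₀) (suc k₁) (suc k₂)

  p : Fin (suc K) → Word (suc k₀)
  p = pt N

  q : Fin (suc K) → Word (suc k₁)
  q = pt M

  module Skew {x₁ : Word (suc k₁)} {y₀ : Word (suc k₀)} {x₂ y₂ : Word (suc k₂)}
              (x₂≢y₂ : x₂ ≢ y₂) (o : Fin (3 + K)) where

    u v : V
    u = x₂ , x₁ , x₀ , 0F
    v = y₂ , y₁ , y₀ , 1F

    y₂≢x₂ : y₂ ≢ x₂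
    y₂≢x₂ = ≢-sym x₂≢y₂

    col : V → Maybe (Fin (3 + K))
    col (c , b , a , 0F) = when c is x₂
      then when b is x₁ then when a is x₀ then nothing else just (label 1F N a) else just 0F
      else when b is y₁ then just 1F else just (label 2F M b)
    col (c , b , a , 1F) = when c is x₂
      then when a is x₀ then just o else just (label 1F N a)
      else when b is y₁ then nothing else just (label 2F M b)
    col (c , b , a , 2F) = when b is y₁
      then when a is y₀ then just 0F else just 1F
      else just (label 2F M b)

    Member : Fin (3 + K) → Set
    Member i = Route E (λ w → col w ≡ just i) u v (suc k₀ + suc k₁ + suc k₂ + 4)

    generic : ∀ i → Member (suc (suc (suc i)))
    generic i = route (E1 (adjacent N (suc i)))
      (fit
        (at (trans when-yes (trans when-yes (trans (when-no p≢x₀) (cong just (label-hit N i))))) ⟨ turn ⟩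
         line₁ x₁ (q (suc i)) (λ b → trans when-yes (trans (when-no p≢x₀) (cong just (label-hit N i)))) ⟨ turn ⟩
         line₂ x₂ y₂ (λ c → trans (when-no q≢y₁) (cong just (label-hit M i))) ⟨ turn ⟩
         line₀ (p (suc i)) y₀ (λ a → trans (when-no y₂≢x₂) (trans (when-no q≢y₁) (cong just (label-hit M i)))) ⟨ turn ⟩
         at (trans (when-no y₂≢x₂) (trans (when-no q≢y₁) (cong just (label-hit M i)))))
        0 (solve (k₀ L.∷ k₁ L.∷ k₂ L.∷ L.[])))
      (E2 (adjacent-sym M (suc i)))
      where
      p≢x₀ = pt≢centre N (suc i)
      q≢y₁ = pt≢centre M (suc i)

    assemble : Member 0F → Member 1F → Member 2F → Family E u v (2 + K) (suc k₀ + suc k₁ + suc k₂ + 4)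
    assemble R₀ R₁ R₂ = record
      { colour = col
      ; colour-u = trans when-yes (trans when-yes when-yes)
      ; colour-v = trans (when-no y₂≢x₂) when-yes
      ; member = λ where
          0F → inj₂ R₀
          1F → inj₂ R₁
          2F → inj₂ R₂
          (suc (suc (suc i))) → inj₂ (generic i) }

  skew : ∀ {x₁ y₀ x₂ y₂} → x₁ ≢ y₁ → x₂ ≢ y₂ → p zero ≢ y₀ →
         Walk (Hamming (suc k₁)) (OnApproach M) x₁ (q zero) k₁ →
         Family E (x₂ , x₁ , x₀ , 0F) (y₂ , y₁ , y₀ , 1F) (2 + K) (suc k₀ + suc k₁ + suc k₂ + 4)
  skew {x₁} {y₀} {x₂} {y₂} x₁≢y₁ x₂≢y₂ p≢y₀ W = assemble
    (route turn
      (fit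
        (line₁ x₁ y₁ (λ b → trans when-yes when-yes) ⟨ turn ⟩
         line₀ x₀ y₀ (λ a → trans when-yes (when-no (≢-sym x₁≢y₁))) ⟨ turn ⟩
         line₂ x₂ y₂ (λ c → trans when-yes when-yes))
        2 (solve (k₀ L.∷ k₁ L.∷ k₂ L.∷ L.[])))
      turn)
    (route (E1 (adjacent N zero))
      (fit
        (at (trans when-yes (trans when-yes (trans (when-no p≢x₀) (cong just (label-anchor N))))) ⟨ turn ⟩
         line₁ x₁ y₁ (λ b → trans when-yes (trans (when-no p≢x₀) (cong just (label-anchor N)))) ⟨ turn ⟩
         line₂ x₂ y₂ (λ c → trans when-yes (when-no p≢y₀)) ⟨ turn ⟩
         line₀ (p zero) y₀ (λ a → trans (when-no y₂≢x₂) when-yes))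
        1 (solve (k₀ L.∷ k₁ L.∷ k₂ L.∷ L.[])))
      turn)
    (route turn
      (fit
        (line₂ x₂ y₂ (λ c → trans (when-no x₁≢y₁) (cong just (label-miss M (approach-misses M (starts _ W))))) ⟨ turn ⟩
         mapWalk (λ b → y₂ , b , x₀ , 1F) E2
           (λ b on → trans (when-no y₂≢x₂) (trans (when-no (proj₁ on))
                       (cong just (label-miss M (approach-misses M on))))) W ⟨ turn ⟩
         line₀ x₀ y₀ (λ a → trans (when-no y₂≢x₂) (trans (when-no q≢y₁) (cong just (label-anchor M)))) ⟨ turn ⟩
         at (trans (when-no y₂≢x₂) (trans (when-no q≢y₁) (cong just (label-anchor M)))))
        2 (solve (k₀ L.∷ k₁ L.∷ k₂ L.∷ L.[])))
      (E2 (adjacent-sym M zero)))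
    where
    open Skew {x₁} {y₀} x₂≢y₂ 0F
    p≢x₀ = pt≢centre N zero
    q≢y₁ = pt≢centre M zero

  vertical : ∀ {x₂ y₂} → x₂ ≢ y₂ →
             Family E (x₂ , y₁ , x₀ , 0F) (y₂ , y₁ , x₀ , 1F) (2 + K) (suc k₀ + suc k₁ + suc k₂ + 4)
  vertical {x₂} {y₂} x₂≢y₂ = assemble
    (route turn
      (fit (line₂ x₂ y₂ (λ c → trans when-yes when-yes)) (6 + k₀ + k₁) (solve (k₀ L.∷ k₁ L.∷ k₂ L.∷ L.[])))
      turn)
    (route (E1 (adjacent N zero))
      (fit
        (at (trans when-yes (trans when-yes (trans (when-no p≢x₀) (cong just (label-anchor N))))) ⟨ turn ⟩
         line₂ x₂ y₂ (λ c → trans when-yes (when-no p≢x₀)) ⟨ turn ⟩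
         line₀ (p zero) x₀ (λ a → trans (when-no y₂≢x₂) when-yes))
        (3 + k₁) (solve (k₀ L.∷ k₁ L.∷ k₂ L.∷ L.[])))
      turn)
    (route turn
      (fit
        (line₁ y₁ (q zero) (λ b → trans when-yes when-yes) ⟨ turn ⟩
         line₂ x₂ y₂ (λ c → trans (when-no q≢y₁) (cong just (label-anchor M))) ⟨ turn ⟩
         at (trans (when-no y₂≢x₂) (trans (when-no q≢y₁) (cong just (label-anchor M)))))
        (3 + k₀) (solve (k₀ L.∷ k₁ L.∷ k₂ L.∷ L.[])))
      (E2 (adjacent-sym M zero)))
    where
    open Skew {y₁} {x₀} x₂≢y₂ 2F
    p≢x₀ = pt≢centre N zero
    q≢y₁ = pt≢centre M zero

  module Flat {x₁ : Word (suc k₁)} {y₀ : Word (suc k₀)} {z : Word (suc k₂)}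
              (p≢y₀ : ∀ i → p (suc i) ≢ y₀) (q≢x₁ : ∀ i → q (suc i) ≢ x₁)
              (o₀ o₁ oₚ oq : Fin (3 + K)) where

    u v : V
    u = z , x₁ , x₀ , 0F
    v = z , y₁ , y₀ , 1F

    col : V → Maybe (Fin (3 + K))
    col (c , b , a , 0F) = when c is z
      then when b is x₁
        then when a is x₀ then nothing else just (label oₚ N a)
        else when b is y₁ then just o₀ else just (label oq M b)
      else just 2F
    col (c , b , a , 1F) = when c is z
      then when a is y₀
        then when b is y₁ then nothing else just (label oq M b)
        else when a is x₀ then just o₁ else just (label oₚ N a)
      else just 2F
    col (c , b , a , 2F) = just 2F

    Member : Fin (3 + K) → Set
    Member i = Route E (λ w → col w ≡ just i) u v (suc k₀ + suc k₁ + suc k₂ + 4)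

    generic : ∀ {l} i → p i ≢ y₀ → q i ≢ x₁ → label oₚ N (p i) ≡ l → label oq M (q i) ≡ l → Member l
    generic i p≢y₀ q≢x₁ eqₚ eq-q = route (E1 (adjacent N i))
      (fit
        (at (trans when-yes (trans when-yes (trans (when-no p≢x₀) (cong just eqₚ)))) ⟨ turn ⟩
         line₁ x₁ (q i)
           (λ b → trans when-yes (trans (when-no p≢y₀) (trans (when-no p≢x₀) (cong just eqₚ)))) ⟨ turn ⟩
         line₀ (p i) y₀
           (λ a → trans when-yes (trans (when-no q≢x₁) (trans (when-no q≢y₁) (cong just eq-q)))) ⟨ turn ⟩
         at (trans when-yes (trans when-yes (trans (when-no q≢y₁) (cong just eq-q)))))
        (2 + k₂) (solve (k₀ L.∷ k₁ L.∷ k₂ L.∷ L.[])))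
      (E2 (adjacent-sym M i))
      where
      p≢x₀ = pt≢centre N i
      q≢y₁ = pt≢centre M i

    detour : Member 2F
    detour with neighbour-avoiding z z
    ... | c′ , z~c′ , c′≢z = route turn
      (fit
        (two refl (E3 z~c′) refl ⟨ turn ⟩
         line₀ x₀ y₀ (λ a → when-no c′≢z) ⟨ turn ⟩
         line₁ x₁ y₁ (λ b → when-no c′≢z) ⟨ turn ⟩
         two refl (E3 (DifferInOne-sym z c′ z~c′)) refl)
        k₂ (solve (k₀ L.∷ k₁ L.∷ k₂ L.∷ L.[])))
      turn

    assemble : u ~ v ⊎ Member 0F → Member 1F → Family E u v (2 + K) (suc k₀ + suc k₁ + suc k₂ + 4)
    assemble R₀ R₁ = record
      { colour = col
      ; colour-u = trans when-yes (trans when-yes when-yes)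
      ; colour-v = trans when-yes (trans when-yes when-yes)
      ; member = λ where
          0F → Sum.map (refl ,_) id R₀
          1F → inj₂ R₁
          2F → inj₂ detour
          (suc (suc (suc i))) → inj₂ (generic (suc i) (p≢y₀ i) (q≢x₁ i) (label-hit N i) (label-hit M i)) }

  flat : ∀ {x₁ y₀ z} → x₀ ≢ y₀ → x₁ ≢ y₁ →
         Walk (Hamming (suc k₀)) (OnApproach N) (p zero) y₀ k₀ →
         Walk (Hamming (suc k₁)) (OnApproach M) x₁ (q zero) k₁ →
         Family E (z , x₁ , x₀ , 0F) (z , y₁ , y₀ , 1F) (2 + K) (suc k₀ + suc k₁ + suc k₂ + 4)
  flat {x₁} {y₀} {z} x₀≢y₀ x₁≢y₁ W₀ W₁ = assemble
    (inj₂ (route turn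
      (fit
        (line₁ x₁ y₁ (λ b → trans when-yes (trans (when-no x₀≢y₀) when-yes)) ⟨ turn ⟩
         line₀ x₀ y₀ (λ a → trans when-yes (trans (when-no (≢-sym x₁≢y₁)) when-yes)))
        (4 + k₂) (solve (k₀ L.∷ k₁ L.∷ k₂ L.∷ L.[])))
      turn))
    (route (E1 (adjacent N zero))
      (fit
        (mapWalk (λ a → z , x₁ , a , 0F) E1
           (λ a on → trans when-yes (trans when-yes (trans (when-no (proj₁ on))
                       (cong just (label-miss N (approach-misses N on)))))) W₀ ⟨ turn ⟩
         mapWalk (λ b → z , b , y₀ , 1F) E2
           (λ b on → trans when-yes (trans when-yes (trans (when-no (proj₁ on))
                       (cong just (label-miss M (approach-misses M on)))))) W₁)
        (6 + k₂) (solve (k₀ L.∷ k₁ L.∷ k₂ L.∷ L.[])))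
      (E2 (adjacent-sym M zero)))
    where
    open Flat {x₁} {y₀} {z} (λ i → ≢-sym (approach-misses N (ends _ W₀) i))
                            (λ i → ≢-sym (approach-misses M (starts _ W₁) i)) 0F 0F 1F 1F

  flat-line : ∀ {x₁ z} → x₁ ≢ y₁ → Walk (Hamming (suc k₁)) (OnApproach M) x₁ (q zero) k₁ →
              Family E (z , x₁ , x₀ , 0F) (z , y₁ , x₀ , 1F) (2 + K) (suc k₀ + suc k₁ + suc k₂ + 4)
  flat-line {x₁} {z} x₁≢y₁ W = assemble
    (inj₂ (route turn
      (fit
        (mapWalk (λ b → z , b , x₀ , 1F) E2
           (λ b on → trans when-yes (trans when-yes (trans (when-no (proj₁ on))
                       (cong just (label-miss M (approach-misses M on)))))) W)
        (7 + k₀ + k₂) (solve (k₀ L.∷ k₁ L.∷ k₂ L.∷ L.[])))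
      (E2 (adjacent-sym M zero))))
    (route (E1 (adjacent N zero))
      (fit
        (at (trans when-yes (trans when-yes (trans (when-no p≢x₀) (cong just (label-anchor N))))) ⟨ turn ⟩
         line₁ x₁ y₁
           (λ b → trans when-yes (trans (when-no p≢x₀) (trans (when-no p≢x₀) (cong just (label-anchor N))))) ⟨ turn ⟩
         line₀ (p zero) x₀ (λ a → trans when-yes (trans (when-no (≢-sym x₁≢y₁)) when-yes)))
        (3 + k₂) (solve (k₀ L.∷ k₁ L.∷ k₂ L.∷ L.[])))
      turn)
    where
    open Flat {x₁} {x₀} {z} (λ i → pt≢centre N (suc i))
                            (λ i → ≢-sym (approach-misses M (starts _ W) i)) 1F 1F 1F 0F
    p≢x₀ = pt≢centre N zero

  rung : ∀ {z} → Family E (z , y₁ , x₀ , 0F) (z , y₁ , x₀ , 1F) (2 + K) (suc k₀ + suc k₁ + suc k₂ + 4)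
  rung {z} = assemble (inj₁ turn)
    (generic zero (pt≢centre N zero) (pt≢centre M zero) (label-anchor N) (label-anchor M))
    where
    open Flat {y₁} {x₀} {z} (λ i → pt≢centre N (suc i)) (λ i → pt≢centre M (suc i)) 1F 1F 1F 1F

-- Axis symmetries

record Connected (m r s t : ℕ) (u v : E3CVertex r s t) : Set where
  constructor connection
  field
    {size} : ℕ
    wide   : 2 + suc m * 2 ≤ suc size
    family : Family (E3C r s t) u v size (r + s + t + 4)

module _ {r s t : ℕ} where

  exchange₀₁ : E3CVertex r s t → E3CVertex r t s
  exchange₀₁ (A , B , C , 0F) = A , C , B , 1F
  exchange₀₁ (A , B , C , 1F) = A , C , B , 0F
  exchange₀₁ (A , B , C , 2F) = A , C , B , 2F

  exchange₁₂ : E3CVertex r s t → E3CVertex s r t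
  exchange₁₂ (A , B , C , 0F) = B , A , C , 0F
  exchange₁₂ (A , B , C , 1F) = B , A , C , 2F
  exchange₁₂ (A , B , C , 2F) = B , A , C , 1F

  exchange₀₁-hom : ∀ {x y} → E3CAdj r s t x y → E3CAdj r t s (exchange₀₁ x) (exchange₀₁ y)
  exchange₀₁-hom (E0 {d = 0F} {0F} ne) = contradiction refl ne
  exchange₀₁-hom (E0 {d = 0F} {1F} ne) = E0 λ ()
  exchange₀₁-hom (E0 {d = 0F} {2F} ne) = E0 λ ()
  exchange₀₁-hom (E0 {d = 1F} {0F} ne) = E0 λ ()
  exchange₀₁-hom (E0 {d = 1F} {1F} ne) = contradiction refl ne
  exchange₀₁-hom (E0 {d = 1F} {2F} ne) = E0 λ ()
  exchange₀₁-hom (E0 {d = 2F} {0F} ne) = E0 λ ()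
  exchange₀₁-hom (E0 {d = 2F} {1F} ne) = E0 λ ()
  exchange₀₁-hom (E0 {d = 2F} {2F} ne) = contradiction refl ne
  exchange₀₁-hom (E1 δ) = E2 δ
  exchange₀₁-hom (E2 δ) = E1 δ
  exchange₀₁-hom (E3 δ) = E3 δ

  exchange₁₂-hom : ∀ {x y} → E3CAdj r s t x y → E3CAdj s r t (exchange₁₂ x) (exchange₁₂ y)
  exchange₁₂-hom (E0 {d = 0F} {0F} ne) = contradiction refl ne
  exchange₁₂-hom (E0 {d = 0F} {1F} ne) = E0 λ ()
  exchange₁₂-hom (E0 {d = 0F} {2F} ne) = E0 λ ()
  exchange₁₂-hom (E0 {d = 1F} {0F} ne) = E0 λ ()
  exchange₁₂-hom (E0 {d = 1F} {1F} ne) = contradiction refl ne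
  exchange₁₂-hom (E0 {d = 1F} {2F} ne) = E0 λ ()
  exchange₁₂-hom (E0 {d = 2F} {0F} ne) = E0 λ ()
  exchange₁₂-hom (E0 {d = 2F} {1F} ne) = E0 λ ()
  exchange₁₂-hom (E0 {d = 2F} {2F} ne) = contradiction refl ne
  exchange₁₂-hom (E1 δ) = E1 δ
  exchange₁₂-hom (E2 δ) = E3 δ
  exchange₁₂-hom (E3 δ) = E2 δ

exchange₀₁-involutive : ∀ {r s t} (x : E3CVertex r s t) → exchange₀₁ (exchange₀₁ x) ≡ x
exchange₀₁-involutive (_ , _ , _ , 0F) = refl
exchange₀₁-involutive (_ , _ , _ , 1F) = refl
exchange₀₁-involutive (_ , _ , _ , 2F) = refl

exchange₁₂-involutive : ∀ {r s t} (x : E3CVertex r s t) → exchange₁₂ (exchange₁₂ x) ≡ x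
exchange₁₂-involutive (_ , _ , _ , 0F) = refl
exchange₁₂-involutive (_ , _ , _ , 1F) = refl
exchange₁₂-involutive (_ , _ , _ , 2F) = refl

module _ {m r s t : ℕ} {u v : E3CVertex r s t} where

  connected-sym : Connected m r s t u v → Connected m r s t v u
  connected-sym (connection wide F) = connection wide (reverseFamily _ F)

  connected₀₁ : Connected m r s t u v → Connected m r t s (exchange₀₁ u) (exchange₀₁ v)
  connected₀₁ (connection wide F) = connection wide
    (subst (Family _ _ _ _) (commute r s t) (mapFamily exchange₀₁ exchange₀₁-hom exchange₀₁ exchange₀₁-involutive F))
    where
    commute : ∀ r s t → r + s + t + 4 ≡ r + t + s + 4
    commute = solve-∀

  connected₁₂ : Connected m r s t u v → Connected m s r t (exchange₁₂ u) (exchange₁₂ v)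
  connected₁₂ (connection wide F) = connection wide
    (subst (Family _ _ _ _) (commute r s t) (mapFamily exchange₁₂ exchange₁₂-hom exchange₁₂ exchange₁₂-involutive F))
    where
    commute : ∀ r s t → r + s + t + 4 ≡ s + r + t + 4
    commute = solve-∀

reorder : ∀ r s t → t + s + r + 4 ≡ r + s + t + 4
reorder = solve-∀

module _ {m k₀ k₁ k₂ : ℕ} (m≤k₀ : m ≤ k₀) where

  open SameLayer {k₀} {k₁} {k₂}

  widen : ∀ {u v : V} → Family E u v (3 + k₀ * 2) (suc k₀ + suc k₁ + suc k₂ + 4) →
          Connected m (suc k₂) (suc k₁) (suc k₀) u v
  widen F = connection (ℕ.+-monoʳ-≤ 4 (ℕ.*-monoˡ-≤ 2 m≤k₀))
    (subst (Family _ _ _ _) (reorder (suc k₂) (suc k₁) (suc k₀)) F)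

  connected-level : ∀ {x₀ y₀ x₁ x₂ y₂} → x₂ ≢ y₂ → (x₀ ≢ y₀ → DifferInOne x₀ y₀) →
                    Connected m (suc k₂) (suc k₁) (suc k₀) (x₂ , x₁ , x₀ , 0F) (y₂ , x₁ , y₀ , 0F)
  connected-level {x₀} {y₀} x₂≢y₂ near with x₀ ≟ y₀
  ... | yes refl = widen (over-level (fan-around (neighbours x₀)) refl)
  ... | no x₀≢y₀ = widen (close-level (fan x₀ y₀ x₀≢y₀) (near x₀≢y₀) x₂≢y₂)

connected-same : ∀ {m k₀ k₁ k₂} → m ≤ k₀ → ∀ {x₀ y₀ x₁ y₁ x₂ y₂} → ¬ (x₂ ≡ y₂ × x₁ ≡ y₁ × x₀ ≡ y₀) →
                 Connected m (suc k₂) (suc k₁) (suc k₀) (x₂ , x₁ , x₀ , 0F) (y₂ , y₁ , y₀ , 0F)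
connected-same m≤k₀ {x₀} {y₀} {x₁} {y₁} {x₂} {y₂} u≢v with x₀ ≟ y₀ | differInOne? x₀ y₀ | x₁ ≟ y₁ | x₂ ≟ y₂
... | yes refl | _ | yes refl | yes refl = contradiction (refl , refl , refl) u≢v
... | no x₀≢y₀ | _ | yes x₁≡y₁ | yes x₂≡y₂ =
  widen m≤k₀ (SameLayer.far-apart (fan x₀ y₀ x₀≢y₀) λ _ → x₁≡y₁ , x₂≡y₂)
... | no x₀≢y₀ | no x₀≁y₀ | _ | _ =
  widen m≤k₀ (SameLayer.far-apart (fan x₀ y₀ x₀≢y₀) λ δ → contradiction δ x₀≁y₀)
... | yes refl | _ | no x₁≢y₁ | no x₂≢y₂ =
  widen m≤k₀ (SameLayer.over (fan-around (neighbours x₀)) refl x₁≢y₁ x₂≢y₂)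
... | no x₀≢y₀ | yes x₀~y₀ | no x₁≢y₁ | no x₂≢y₂ =
  widen m≤k₀ (SameLayer.close (fan x₀ y₀ x₀≢y₀) x₀~y₀ x₁≢y₁ x₂≢y₂)
... | yes x₀≡y₀ | _ | yes refl | no x₂≢y₂ = connected-level m≤k₀ x₂≢y₂ (contradiction x₀≡y₀)
... | no _ | yes x₀~y₀ | yes refl | no x₂≢y₂ = connected-level m≤k₀ x₂≢y₂ λ _ → x₀~y₀
... | yes x₀≡y₀ | _ | no x₁≢y₁ | yes refl = connected₁₂ (connected-level m≤k₀ x₁≢y₁ (contradiction x₀≡y₀))
... | no _ | yes x₀~y₀ | no x₁≢y₁ | yes refl = connected₁₂ (connected-level m≤k₀ x₁≢y₁ λ _ → x₀~y₀)

some-neighbours : ∀ {m k} → m ≤ k → (x : Word (suc k)) → Neighbours x (suc m * 2)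
some-neighbours m≤k x = restrict (ℕ.*-monoˡ-≤ 2 (s≤s m≤k)) (neighbours x)

approach-neighbours : ∀ {m k} → m ≤ k → {x y : Word (suc k)} → x ≢ y →
  Σ (Neighbours y (suc m * 2)) λ N → Walk (Hamming (suc k)) (OnApproach N) x (pt N zero) k
approach-neighbours m≤k {x} {y} x≢y with approach x y x≢y
... | record { gate = g ; gate~y = g~y ; approach = W } with anchor {z = g} g~y (some-neighbours m≤k y)
...   | N , refl = N , W

module _ {m k₀ k₁ k₂ : ℕ} where

  exact : ∀ {u v : E3CVertex (suc k₂) (suc k₁) (suc k₀)} →
          Family (E3C (suc k₂) (suc k₁) (suc k₀)) u v (3 + m * 2) (suc k₀ + suc k₁ + suc k₂ + 4) →
          Connected m (suc k₂) (suc k₁) (suc k₀) u v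
  exact F = connection ℕ.≤-refl (subst (Family _ _ _ _) (reorder (suc k₂) (suc k₁) (suc k₀)) F)

  connected-distinct : m ≤ k₀ → m ≤ k₁ → ∀ {x₀ y₀ x₁ y₁ x₂ y₂} → x₁ ≢ y₁ →
                       Connected m (suc k₂) (suc k₁) (suc k₀) (x₂ , x₁ , x₀ , 0F) (y₂ , y₁ , y₀ , 1F)
  connected-distinct m≤k₀ m≤k₁ {x₀} {y₀} {x₁} {y₁} {x₂} {y₂} x₁≢y₁ with x₂ ≟ y₂ | x₀ ≟ y₀ | approach-neighbours m≤k₁ x₁≢y₁
  ... | yes refl | yes refl | M , W = exact (AcrossLayers.flat-line (some-neighbours m≤k₀ x₀) M x₁≢y₁ W)
  ... | yes refl | no x₀≢y₀ | M , W with approach-neighbours m≤k₀ (≢-sym x₀≢y₀)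
  ...   | N , W₀ = exact (AcrossLayers.flat N M x₀≢y₀ x₁≢y₁ (reverse _ W₀) W)
  connected-distinct m≤k₀ m≤k₁ {x₀} {y₀} x₁≢y₁ | no x₂≢y₂ | _ | M , W with neighbour-avoiding x₀ y₀
  ... | a , x₀~a , a≢y₀ with anchor {z = a} x₀~a (some-neighbours m≤k₀ x₀)
  ...   | N , refl = exact (AcrossLayers.skew N M x₁≢y₁ x₂≢y₂ a≢y₀ W)

connected-across : ∀ {m k₀ k₁ k₂} → m ≤ k₀ → m ≤ k₁ → ∀ {x₀ y₀ x₁ y₁ x₂ y₂} →
                   Connected m (suc k₂) (suc k₁) (suc k₀) (x₂ , x₁ , x₀ , 0F) (y₂ , y₁ , y₀ , 1F)
connected-across m≤k₀ m≤k₁ {x₀} {y₀} {x₁} {y₁} {x₂} {y₂} with x₁ ≟ y₁ | x₀ ≟ y₀ | x₂ ≟ y₂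
... | no x₁≢y₁ | _ | _ = connected-distinct m≤k₀ m≤k₁ x₁≢y₁
... | yes refl | no x₀≢y₀ | _ = connected₀₁ (connected-sym (connected-distinct m≤k₁ m≤k₀ (≢-sym x₀≢y₀)))
... | yes refl | yes refl | no x₂≢y₂ = exact
  (AcrossLayers.vertical (some-neighbours m≤k₀ x₀) (some-neighbours m≤k₁ x₁) x₂≢y₂)
... | yes refl | yes refl | yes refl = exact
  (AcrossLayers.rung (some-neighbours m≤k₀ x₀) (some-neighbours m≤k₁ x₁))

connected : ∀ {m r s t} → suc m ≤ r → suc m ≤ s → suc m ≤ t → ∀ u v → u ≢ v → Connected m r s t u v
connected (s≤s r≥) (s≤s s≥) (s≤s t≥) (A , B , C , 0F) (A′ , B′ , C′ , 0F) u≢v = connected-same t≥ λ { (refl , refl , refl) → u≢v refl }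
connected (s≤s r≥) (s≤s s≥) (s≤s t≥) (A , B , C , 1F) (A′ , B′ , C′ , 1F) u≢v =
  connected₀₁ (connected-same s≥ λ { (refl , refl , refl) → u≢v refl })
connected (s≤s r≥) (s≤s s≥) (s≤s t≥) (A , B , C , 2F) (A′ , B′ , C′ , 2F) u≢v =
  connected₁₂ (connected₀₁ (connected-same r≥ λ { (refl , refl , refl) → u≢v refl }))
connected (s≤s r≥) (s≤s s≥) (s≤s t≥) (A , B , C , 0F) (A′ , B′ , C′ , 1F) _ = connected-across t≥ s≥
connected (s≤s r≥) (s≤s s≥) (s≤s t≥) (A , B , C , 1F) (A′ , B′ , C′ , 0F) _ = connected-sym (connected-across t≥ s≥)
connected (s≤s r≥) (s≤s s≥) (s≤s t≥) (A , B , C , 0F) (A′ , B′ , C′ , 2F) _ = connected₁₂ (connected-across t≥ r≥)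
connected (s≤s r≥) (s≤s s≥) (s≤s t≥) (A , B , C , 2F) (A′ , B′ , C′ , 0F) _ =
  connected-sym (connected₁₂ (connected-across t≥ r≥))
connected (s≤s r≥) (s≤s s≥) (s≤s t≥) (A , B , C , 1F) (A′ , B′ , C′ , 2F) _ =
  connected₀₁ (connected₁₂ (connected-across s≥ r≥))
connected (s≤s r≥) (s≤s s≥) (s≤s t≥) (A , B , C , 2F) (A′ , B′ , C′ , 1F) _ =
  connected-sym (connected₀₁ (connected₁₂ (connected-across s≥ r≥)))

_≟V_ : ∀ {r s t} → DecidableEquality (E3CVertex r s t)
_≟V_ = ≡-dec _≟_ (≡-dec _≟_ (≡-dec _≟_ Fin._≟_))

adjacent? : ∀ {r s t} (x y : E3CVertex r s t) → Dec (E3CAdj r s t x y)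
adjacent? (A , B , C , d) (A′ , B′ , C′ , d′) with d Fin.≟ d′
... | no d≢d′ = map′ (λ { (refl , refl , refl) → E0 d≢d′ })
  (λ { (E0 _) → refl , refl , refl ; (E1 _) → contradiction refl d≢d′
     ; (E2 _) → contradiction refl d≢d′ ; (E3 _) → contradiction refl d≢d′ })
  (A ≟ A′ ×-dec B ≟ B′ ×-dec C ≟ C′)
adjacent? (A , B , C , 0F) (A′ , B′ , C′ , 0F) | yes refl = map′ (λ { (refl , refl , δ) → E1 δ })
  (λ { (E0 ne) → contradiction refl ne ; (E1 δ) → refl , refl , δ }) (A ≟ A′ ×-dec B ≟ B′ ×-dec differInOne? C C′)
adjacent? (A , B , C , 1F) (A′ , B′ , C′ , 1F) | yes refl = map′ (λ { (refl , refl , δ) → E2 δ })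
  (λ { (E0 ne) → contradiction refl ne ; (E2 δ) → refl , refl , δ }) (A ≟ A′ ×-dec C ≟ C′ ×-dec differInOne? B B′)
adjacent? (A , B , C , 2F) (A′ , B′ , C′ , 2F) | yes refl = map′ (λ { (refl , refl , δ) → E3 δ })
  (λ { (E0 ne) → contradiction refl ne ; (E3 δ) → refl , refl , δ }) (B ≟ B′ ×-dec C ≟ C′ ×-dec differInOne? A A′)

search-vertices : ∀ r s t → Searchable (E3CVertex r s t)
search-vertices r s t = search-× (search-Vec Fin.any? r)
  (search-× (search-Vec Fin.any? s) (search-× (search-Vec Fin.any? t) Fin.any?))

theorem2 : ∀ (r s t n : ℕ) → 1 ≤ r → r ≤ s → s ≤ t → n ≡ r + s + t + 1 →
    ∃ λ D → IsWideDiameter (E3C r s t) (2 * r + 2) D × D ≤ r + s + t + 6 × r + s + t + 6 ≡ n + 5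
theorem2 r@(suc m) s t n 1≤r r≤s s≤t refl =
  let D , isDiameter , D≤ = diameter in
  D , subst (λ β → IsWideDiameter (E3C r s t) β D) (width m) isDiameter ,
  subst (D ≤_) (bound r s t) D≤ , order r s t
  where
  open WideDistance (E3C r s t) _≟V_ adjacent? (search-vertices r s t)
  width : ∀ m → 2 + suc m * 2 ≡ 2 * suc m + 2
  width = solve-∀
  bound : ∀ r s t → suc (suc (r + s + t + 4)) ≡ r + s + t + 6
  bound = solve-∀
  order : ∀ r s t → r + s + t + 6 ≡ r + s + t + 1 + 5
  order = solve-∀
  corner : Fin 3 → E3CVertex r s t
  corner d = replicate r 0F , replicate s 0F , replicate t 0F , d
  diameter : ∃ λ D → IsWideDiameter (E3C r s t) (2 + suc m * 2) D × D ≤ suc (suc (r + s + t + 4))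
  diameter = wideDiameter _ _ (corner 0F , corner 1F , λ ()) λ u v u≢v →
    let connection wide F = connected ℕ.≤-refl r≤s (ℕ.≤-trans r≤s s≤t) u v u≢v in
    disjointPaths _ _≟V_ u≢v F wide
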